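{- Let $f,g\colon A\vdash B$ be two terms of the same type $A\vdash B$ such that $A\vdash B$ is balanced and both $A$ and $B$ are proper $\alpha$-formulae. Then $f=g$ (in the equational theory of terms described in the context).
   Context: Formulae are built from an infinite set of propositional letters and a constant $I$ using binary connectives $\otimes$ and $\to$. An $\alpha$-formula is a formula considered up to strict associativity of $\otimes$ and strict unitality of $I$: $A\otimes(B\otimes C)$ and $(A\otimes B)\otimes C$ are identified (written $A\otimes B\otimes C$), and $A\otimes I$, $I\otimes A$ are identified with $A$ (also inside subformulae). Thus $\otimes$ on $\alpha$-formulae is an operation with unit $I$. Terms with types: we write $f\colon A\vdash B$ ($A,B$ $\alpha$-formulae). Primitive terms: $\mathbf{1}_A\colon A\vdash A$, $c_{B,A}\colon B\otimes A\vdash A\otimes B$, $\eta_{A,B}\colon B\vdash A\to(A\otimes B)$, $\varepsilon_{A,B}\colon A\otimes(A\to B)\vdash B$. If $f\colon A\vdash B$, $g\colon B\vdash C$ then $g\circ f\colon A\vdash C$; if $f_i\colon A_i\vdash B_i$ then $f_1\otimes f_2\colon A_1\otimes A_2\vdash B_1\otimes B_2$; if $f\colon B_1\vdash B_2$ and $A$ is an $\alpha$-formula then $A\to f\colon A\to B_1\vdash A\to B_2$. Terms are strict: $f\otimes(g\otimes h)$ and $(f\otimes g)\otimes h$ are identified, and $f\otimes\mathbf 1_I$, $\mathbf 1_I\otimes f$ are identified with $f$. Equality of terms is the smallest congruence (w.r.t. $\circ$, $\otimes$, $A\to$; relating only terms of the same type) containing, for all terms/formulae making both sides well typed: $g\circ\mathbf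 1_A=g$, $\mathbf 1_A\circ f=f$; $h\circ(g\circ f)=(h\circ g)\circ f$; $\mathbf 1_A\otimes\mathbf 1_B=\mathbf 1_{A\otimes B}$; $(g_1\otimes g_2)\circ(f_1\otimes f_2)=(g_1\circ f_1)\otimes(g_2\circ f_2)$; $c_{A',B'}\circ(f\otimes g)=(g\otimes f)\circ c_{A,B}$ for $f\colon A\vdash A'$, $g\colon B\vdash B'$; $c_{B,A}\circ c_{A,B}=\mathbf 1_{A\otimes B}$; $c_{A\otimes B,C}=(c_{A,C}\otimes\mathbf 1_B)\circ(\mathbf 1_A\otimes c_{B,C})$; $A\to(g\circ f)=(A\to g)\circ(A\to f)$; $\eta_{A,B'}\circ f=(A\to(\mathbf 1_A\otimes f))\circ\eta_{A,B}$ for $f\colon B\vdash B'$; $A\to\mathbf 1_B=\mathbf 1_{A\to B}$; $\varepsilon_{A,B'}\circ(\mathbf 1_A\otimes(A\to f))=f\circ\varepsilon_{A,B}$ for $f\colon B\vdash B'$; $\varepsilon_{A,A\otimes B}\circ(\mathbf 1_A\otimes\eta_{A,B})=\mathbf 1_{A\otimes B}$; $(A\to\varepsilon_{A,B})\circ\eta_{A,A\to B}=\mathbf 1_{A\to B}$. A formula is constant if it contains no propositional letters. A formula is proper if it has no subformula of the form $B\to C$ with $C$ constant and $B$ not constant. An occurrence of a letter in a formula is positive (negative) if it lies in an even (odd) number of antecedents of implications; its sign in a sequent $A\vdash B$ is its sign in $A\to B$. The sequent $A\vdash B$ is balanced if every letter occurring in it has exactly two occurrences and these have opposite signs. -}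

module Defs where

open import Data.Nat using (ℕ)
open import Data.Bool using (Bool; true; false; not)
open import Data.Product using (_×_; _,_; proj₁; proj₂)
open import Data.List using (List; []; _∷_; [_]; _++_; length; filter; map)
open import Data.List.Membership.Propositional using (_∈_)
open import Relation.Nullary using (¬_)
open import Relation.Nullary.Decidable using (_×-dec_)
open import Relation.Binary.PropositionalEquality using (_≡_; refl; sym; subst₂)
import Data.Nat as ℕ
import Data.Bool as 𝔹

-- α-formulae, represented canonically: an α-formula is a (possibly
-- empty) ⊗-list of factors, each factor being a letter or an
-- implication of α-formulae.  The empty list is I and ⊗ is
-- concatenation, so strict associativity and unitality hold
-- literally (as propositional equality of normal forms).

infixr 5 _∷_
infixr 6 _⇒_

mutual
  data Fm : Set where
    I   : Fm
    _∷_ : At → Fm → Fm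

  data At : Set where
    var : ℕ → At
    _⇒_ : Fm → Fm → At

infixr 7 _⊗_
_⊗_ : Fm → Fm → Fm
I ⊗ B = B
(a ∷ A) ⊗ B = a ∷ (A ⊗ B)

infixr 6 _⊸_
_⊸_ : Fm → Fm → Fm
A ⊸ B = (A ⇒ B) ∷ I

⊗-assoc : (A B C : Fm) → (A ⊗ B) ⊗ C ≡ A ⊗ (B ⊗ C)
⊗-assoc I B C = refl
⊗-assoc (a ∷ A) B C rewrite ⊗-assoc A B C = refl

⊗-unitʳ : (A : Fm) → A ⊗ I ≡ A
⊗-unitʳ I = refl
⊗-unitʳ (a ∷ A) rewrite ⊗-unitʳ A = refl

infixr 9 _∘_
infixr 7 _⊗t_
infixr 6 _⇒t_

data Tm : Fm → Fm → Set where
  𝟏    : (A : Fm) → Tm A A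
  c    : (A B : Fm) → Tm (A ⊗ B) (B ⊗ A)
  η    : (A B : Fm) → Tm B (A ⊸ (A ⊗ B))
  ε    : (A B : Fm) → Tm (A ⊗ (A ⊸ B)) B
  _∘_  : ∀ {A B C} → Tm B C → Tm A B → Tm A C
  _⊗t_ : ∀ {A₁ A₂ B₁ B₂} → Tm A₁ B₁ → Tm A₂ B₂ → Tm (A₁ ⊗ A₂) (B₁ ⊗ B₂)
  _⇒t_ : ∀ {B₁ B₂} (A : Fm) → Tm B₁ B₂ → Tm (A ⊸ B₁) (A ⊸ B₂)

-- transport of a term along equalities of α-formulae (identity on the
-- strict syntax, needed only because ⊗-assoc is propositional)
cast : ∀ {A A' B B'} → A ≡ A' → B ≡ B' → Tm A B → Tm A' B'
cast p q f = subst₂ Tm p q f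

infix 4 _≈_

data _≈_ : ∀ {A B} → Tm A B → Tm A B → Set where
  ≈-refl  : ∀ {A B} {f : Tm A B} → f ≈ f
  ≈-sym   : ∀ {A B} {f g : Tm A B} → f ≈ g → g ≈ f
  ≈-trans : ∀ {A B} {f g h : Tm A B} → f ≈ g → g ≈ h → f ≈ h
  ∘-cong  : ∀ {A B C} {g g' : Tm B C} {f f' : Tm A B} →
            g ≈ g' → f ≈ f' → g ∘ f ≈ g' ∘ f'
  ⊗-cong  : ∀ {A₁ A₂ B₁ B₂} {f f' : Tm A₁ B₁} {g g' : Tm A₂ B₂} →
            f ≈ f' → g ≈ g' → f ⊗t g ≈ f' ⊗t g'
  ⇒-cong  : ∀ {A B₁ B₂} {f f' : Tm B₁ B₂} → f ≈ f' → (A ⇒t f) ≈ (A ⇒t f')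
  ⊗t-assoc : ∀ {A₁ A₂ A₃ B₁ B₂ B₃}
             (f : Tm A₁ B₁) (g : Tm A₂ B₂) (h : Tm A₃ B₃) →
             cast (⊗-assoc A₁ A₂ A₃) (⊗-assoc B₁ B₂ B₃) ((f ⊗t g) ⊗t h)
               ≈ f ⊗t (g ⊗t h)
  ⊗t-unitʳ : ∀ {A B} (f : Tm A B) →
             cast (⊗-unitʳ A) (⊗-unitʳ B) (f ⊗t 𝟏 I) ≈ f
  ⊗t-unitˡ : ∀ {A B} (f : Tm A B) → 𝟏 I ⊗t f ≈ f
  idʳ     : ∀ {A B} (g : Tm A B) → g ∘ 𝟏 A ≈ g
  idˡ     : ∀ {A B} (f : Tm A B) → 𝟏 B ∘ f ≈ f
  ∘-assoc : ∀ {A B C D} (h : Tm C D) (g : Tm B C) (f : Tm A B) →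
            h ∘ (g ∘ f) ≈ (h ∘ g) ∘ f
  ⊗-id    : (A B : Fm) → 𝟏 A ⊗t 𝟏 B ≈ 𝟏 (A ⊗ B)
  ⊗-∘     : ∀ {A₁ A₂ B₁ B₂ C₁ C₂}
            (g₁ : Tm B₁ C₁) (g₂ : Tm B₂ C₂) (f₁ : Tm A₁ B₁) (f₂ : Tm A₂ B₂) →
            (g₁ ⊗t g₂) ∘ (f₁ ⊗t f₂) ≈ (g₁ ∘ f₁) ⊗t (g₂ ∘ f₂)
  c-nat   : ∀ {A A' B B'} (f : Tm A A') (g : Tm B B') →
            c A' B' ∘ (f ⊗t g) ≈ (g ⊗t f) ∘ c A B
  c-inv   : (A B : Fm) → c B A ∘ c A B ≈ 𝟏 (A ⊗ B)
  c-hex   : (A B C : Fm) →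
            c (A ⊗ B) C ≈
            cast (sym (⊗-assoc A B C)) (⊗-assoc C A B)
              ((c A C ⊗t 𝟏 B) ∘ cast refl (sym (⊗-assoc A C B)) (𝟏 A ⊗t c B C))
  ⇒-∘     : ∀ {B₁ B₂ B₃} (A : Fm) (g : Tm B₂ B₃) (f : Tm B₁ B₂) →
            (A ⇒t (g ∘ f)) ≈ (A ⇒t g) ∘ (A ⇒t f)
  η-nat   : ∀ {B B'} (A : Fm) (f : Tm B B') →
            η A B' ∘ f ≈ (A ⇒t (𝟏 A ⊗t f)) ∘ η A B
  ⇒-id    : (A B : Fm) → (A ⇒t 𝟏 B) ≈ 𝟏 (A ⊸ B)
  ε-nat   : ∀ {B B'} (A : Fm) (f : Tm B B') →
            ε A B' ∘ (𝟏 A ⊗t (A ⇒t f)) ≈ f ∘ ε A B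
  tri₁    : (A B : Fm) → ε A (A ⊗ B) ∘ (𝟏 A ⊗t η A B) ≈ 𝟏 (A ⊗ B)
  tri₂    : (A B : Fm) → (A ⇒t ε A B) ∘ η A (A ⊸ B) ≈ 𝟏 (A ⊸ B)

-- Letter occurrences with signs (true = positive, false = negative).

mutual
  occF : Bool → Fm → List (ℕ × Bool)
  occF s I = []
  occF s (a ∷ A) = occA s a ++ occF s A

  occA : Bool → At → List (ℕ × Bool)
  occA s (var p) = [ (p , s) ]
  occA s (B ⇒ C) = occF (not s) B ++ occF s C

Constant : Fm → Set
Constant A = occF true A ≡ []

mutual
  Proper : Fm → Set
  Proper I = Data.Unit.⊤
    where import Data.Unit
  Proper (a ∷ A) = ProperAt a × Proper A

  ProperAt : At → Set
  ProperAt (var p) = Data.Unit.⊤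
    where import Data.Unit
  ProperAt (B ⇒ C) = ¬ (Constant C × ¬ Constant B) × Proper B × Proper C

-- signed occurrences in the sequent A ⊢ B, i.e. in A → B
seqOcc : Fm → Fm → List (ℕ × Bool)
seqOcc A B = occF false A ++ occF true B

count : ℕ → Bool → List (ℕ × Bool) → ℕ
count p s L = length (filter (λ q → (proj₁ q ℕ.≟ p) ×-dec (proj₂ q 𝔹.≟ s)) L)

Balanced : Fm → Fm → Set
Balanced A B = ∀ p → p ∈ map proj₁ (seqOcc A B) →
               count p true (seqOcc A B) ≡ 1 × count p false (seqOcc A B) ≡ 1

{-# OPTIONS --safe #-}
module Submission where

-- Every term equals the interpretation of a cut-free proof, by a Tait-style computability argument over
-- the terms themselves.  Constant formulae are retracts of I, so for proper formulae one may assume that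
-- no implication has codomain I.  For two terms f and g of the same type, g is then compared with f by
-- induction on a cut-free proof of f.  If this proof ends by splitting the sequent (a tensor on the right
-- or an implication on the left), balancedness makes the letters of the two premises disjoint.  Colouring
-- the letters by the premise they belong to, an induction on a cut-free proof of g shows that g splits in
-- the same way; the only obstruction would be a nonempty context of one colour proving I, or proving a
-- formula of the other colour, and this is excluded because no implication has codomain I.

open import Defs
open import Algebra.Properties.CommutativeSemigroup using (x∙yz≈y∙xz)
open import Data.Bool using (Bool; true; false; not)
open import Data.Bool.Properties using (not-involutive)
open import Data.Empty using (⊥-elim)
open import Data.List using ([]; _∷_; _++_; length; filter; map)
open import Data.List.Membership.Propositional using (_∈_)
open import Data.List.Properties using (filter-++; length-++)
open import Data.List.Relation.Unary.Any using (here; there)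
open import Data.Nat using (ℕ; _+_; _≤_; _<_; z≤n; _<?_; _≡ᵇ_)
open import Data.Nat.Properties
open import Data.Nat.Solver using (module +-*-Solver)
open import Data.Product using (Σ; ∃₂; _×_; _,_; proj₁; proj₂)
open import Data.Sum using (_⊎_; inj₁; inj₂)
open import Relation.Binary.PropositionalEquality using (_≡_; _≢_; refl; sym; trans; cong; cong₂; subst; module ≡-Reasoning)
open import Relation.Nullary using (¬_; does)
open import Relation.Nullary.Decidable using (dec-true; dec-false)

-- No normal form is chosen: cut-free proofs of one sequent may apply their rules in different
-- orders, so the proof of `f` dictates the order and `g` is made to follow it. Cut-freeness is a
-- predicate on terms closed under `≈`, so normalising never changes the term being compared. The
-- obstacle is the unit. A context such as `p`, `p → I` proves `I`, and since its letters are linked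
-- only to each other it could go to either premise of a splitting rule. Once no codomain is `I`, a
-- coloured nonempty formula contains a letter and thus has only one colour. Passing to such
-- formulae is harmless because conjugation by retractions is injective on terms up to `≈`.

variable
  A A' A₁ A₂ A₃ B B' B₁ B₂ B₃ C C' C₁ D D' X Y : Fm
  Γ Γ₁ Γ₂ Δ Δ₁ Δ₂ E₁ E₂ F₁ F₂ Y₁ Y₂ : Fm
  x : At
  P Q : At → Set

pattern [_] a = a ∷ I

-- Strict monoidal structure

infix 4 _≋_

-- Equality of terms up to casts.  With K, f ≋ g at equal types is f ≈ g, so chains of ≋ may pass through
-- terms whose types agree only propositionally.
data _≋_ {A B} (f : Tm A B) : ∀ {A' B'} → Tm A' B' → Set where
  ⟪_⟫ : {g : Tm A B} → f ≈ g → f ≋ g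

≋⇒≈ : {f g : Tm A B} → f ≋ g → f ≈ g
≋⇒≈ ⟪ e ⟫ = e

≋-refl : {f : Tm A B} → f ≋ f
≋-refl = ⟪ ≈-refl ⟫

≋-sym : {f : Tm A B} {g : Tm A' B'} → f ≋ g → g ≋ f
≋-sym ⟪ e ⟫ = ⟪ ≈-sym e ⟫

≋-trans : {f : Tm A B} {g : Tm A' B'} {h : Tm C D} → f ≋ g → g ≋ h → f ≋ h
≋-trans ⟪ e ⟫ ⟪ e' ⟫ = ⟪ ≈-trans e e' ⟫

cast-≋ : (p : A ≡ A') (q : B ≡ B') (f : Tm A B) → cast p q f ≋ f
cast-≋ refl refl f = ≋-refl

infixr 2 step-≋ step-≋˘ step-≈ step-≈˘
infix 3 _∎

step-≋ : (f : Tm A B) {g : Tm A' B'} {h : Tm C D} → g ≋ h → f ≋ g → f ≋ h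
step-≋ f q p = ≋-trans p q

step-≋˘ : (f : Tm A B) {g : Tm A' B'} {h : Tm C D} → g ≋ h → g ≋ f → f ≋ h
step-≋˘ f q p = ≋-trans (≋-sym p) q

step-≈ : (f : Tm A B) {g : Tm A B} {h : Tm C D} → g ≋ h → f ≈ g → f ≋ h
step-≈ f q p = ≋-trans ⟪ p ⟫ q

step-≈˘ : (f : Tm A B) {g : Tm A B} {h : Tm C D} → g ≋ h → g ≈ f → f ≋ h
step-≈˘ f q p = ≋-trans ⟪ ≈-sym p ⟫ q

syntax step-≋ f q p = f ≋⟨ p ⟩ q
syntax step-≋˘ f q p = f ≋˘⟨ p ⟩ q
syntax step-≈ f q p = f ≈⟨ p ⟩ q
syntax step-≈˘ f q p = f ≈˘⟨ p ⟩ q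

_∎ : (f : Tm A B) → f ≋ f
f ∎ = ≋-refl

infixr 9 _∙[_]_

-- Keeping the equality of the middle types as an argument lets associativity and functoriality be
-- proved once by matching on `refl`, with no cast inside the terms.
_∙[_]_ : Tm B' C → B ≡ B' → Tm A B → Tm A C
g ∙[ refl ] f = g ∘ f

infixr 9 _⊚_
infixr 8 _⊠_

_⊚_ : {g : Tm B C} {g' : Tm B' C'} {f : Tm A B} {f' : Tm A' B'} →
      g ≋ g' → f ≋ f' → g ∘ f ≋ g' ∘ f'
⟪ e ⟫ ⊚ ⟪ e' ⟫ = ⟪ ∘-cong e e' ⟫

∙≋ : {g : Tm B' C} {p : B ≡ B'} {f : Tm A B} {g' : Tm D C'} {f' : Tm A' D} →
     g ≋ g' → f ≋ f' → g ∙[ p ] f ≋ g' ∘ f'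
∙≋ {p = refl} e e' = e ⊚ e'

∙-cong : {g : Tm B' C} {p : B ≡ B'} {f : Tm A B} {g' : Tm D' C'} {p' : D ≡ D'} {f' : Tm A' D} →
     g ≋ g' → f ≋ f' → g ∙[ p ] f ≋ g' ∙[ p' ] f'
∙-cong {p = refl} {p' = refl} e e' = e ⊚ e'

∙-assoc : {h : Tm C' D} {p : C ≡ C'} {g : Tm B' C} {q : B ≡ B'} {f : Tm A B} →
          h ∙[ p ] g ∙[ q ] f ≋ (h ∙[ p ] g) ∙[ q ] f
∙-assoc {p = refl} {q = refl} = ⟪ ∘-assoc _ _ _ ⟫

∙-idˡ : {p : B ≡ B'} {f : Tm A B} → 𝟏 B' ∙[ p ] f ≋ f
∙-idˡ {p = refl} = ⟪ idˡ _ ⟫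

_⊠_ : {f : Tm A B} {f' : Tm A' B'} {g : Tm C D} {g' : Tm C' D'} →
      f ≋ f' → g ≋ g' → f ⊗t g ≋ f' ⊗t g'
⟪ e ⟫ ⊠ ⟪ e' ⟫ = ⟪ ⊗-cong e e' ⟫

𝟏≋ : A ≡ B → 𝟏 A ≋ 𝟏 B
𝟏≋ refl = ≋-refl

⊗-assoc-≋ : (f : Tm A₁ B₁) (g : Tm A₂ B₂) (h : Tm A₃ B₃) → (f ⊗t g) ⊗t h ≋ f ⊗t (g ⊗t h)
⊗-assoc-≋ {A₁ = A₁} {B₁ = B₁} {A₂ = A₂} {B₂ = B₂} {A₃ = A₃} {B₃ = B₃} f g h =
  ≋-trans (≋-sym (cast-≋ (⊗-assoc A₁ A₂ A₃) (⊗-assoc B₁ B₂ B₃) _)) ⟪ ⊗t-assoc f g h ⟫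

⊗-unitʳ-≋ : (f : Tm A B) → f ⊗t 𝟏 I ≋ f
⊗-unitʳ-≋ {A = A} {B = B} f = ≋-trans (≋-sym (cast-≋ (⊗-unitʳ A) (⊗-unitʳ B) _)) ⟪ ⊗t-unitʳ f ⟫

infixr 8 _◁_
infixl 7 _▷_

_▷_ : Tm A B → ∀ X → Tm (A ⊗ X) (B ⊗ X)
f ▷ X = f ⊗t 𝟏 X

_◁_ : ∀ X → Tm A B → Tm (X ⊗ A) (X ⊗ B)
X ◁ f = 𝟏 X ⊗t f

▷-∘ : (g : Tm B C) (f : Tm A B) → (g ∘ f) ▷ X ≈ (g ▷ X) ∘ (f ▷ X)
▷-∘ g f = ≈-sym (≈-trans (⊗-∘ _ _ _ _) (⊗-cong ≈-refl (idˡ _)))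

◁-∘ : (g : Tm B C) (f : Tm A B) → X ◁ (g ∘ f) ≈ (X ◁ g) ∘ (X ◁ f)
◁-∘ g f = ≈-sym (≈-trans (⊗-∘ _ _ _ _) (⊗-cong (idˡ _) ≈-refl))

⊗-▷◁ : (f : Tm A B) (g : Tm C D) → f ⊗t g ≈ (f ▷ D) ∘ (A ◁ g)
⊗-▷◁ f g = ≈-sym (≈-trans (⊗-∘ _ _ _ _) (⊗-cong (idʳ _) (idˡ _)))

⊗-◁▷ : (f : Tm A B) (g : Tm C D) → f ⊗t g ≈ (B ◁ g) ∘ (f ▷ C)
⊗-◁▷ f g = ≈-sym (≈-trans (⊗-∘ _ _ _ _) (⊗-cong (idˡ _) (idʳ _)))

▷◁ : (f : Tm A B) (g : Tm C D) → (f ▷ D) ∘ (A ◁ g) ≈ (B ◁ g) ∘ (f ▷ C)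
▷◁ f g = ≈-trans (≈-sym (⊗-▷◁ f g)) (⊗-◁▷ f g)

▷▷ : (f : Tm A B) → (f ▷ X) ▷ Y ≋ f ▷ (X ⊗ Y)
▷▷ f = ≋-trans (⊗-assoc-≋ _ _ _) (≋-refl ⊠ ⟪ ⊗-id _ _ ⟫)

◁◁ : (f : Tm A B) → (X ⊗ Y) ◁ f ≋ X ◁ Y ◁ f
◁◁ f = ≋-trans (⟪ ≈-sym (⊗-id _ _) ⟫ ⊠ ≋-refl) (⊗-assoc-≋ _ _ _)

◁▷ : (f : Tm A B) → (X ◁ f) ▷ Y ≋ X ◁ (f ▷ Y)
◁▷ f = ⊗-assoc-≋ _ _ _

infixr 9 _⨾≈_
_⨾≈_ : {f g h : Tm A B} → f ≈ g → g ≈ h → f ≈ h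
_⨾≈_ = ≈-trans

-- Symmetry

c-hex-≋ : ∀ A B C (p : A ⊗ (C ⊗ B) ≡ (A ⊗ C) ⊗ B) →
          c (A ⊗ B) C ≋ (c A C ▷ B) ∙[ p ] (A ◁ c B C)
c-hex-≋ A B C p =
  c (A ⊗ B) C ≈⟨ c-hex A B C ⟩
  _ ≋⟨ cast-≋ (sym (⊗-assoc A B C)) (⊗-assoc C A B) _ ⟩
  _ ≋˘⟨ ∙≋ ≋-refl (≋-sym (cast-≋ refl (sym (⊗-assoc A C B)) _)) ⟩
  (c A C ▷ B) ∙[ p ] (A ◁ c B C) ∎

-- By the hexagon at A = B = I, c I A is an idempotent isomorphism.
c-I : ∀ A → c I A ≋ 𝟏 A
c-I A = ≋-sym (
  𝟏 A ≈˘⟨ c-inv I A ⟩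
  c A I ∘ c I A ≋⟨ ≋-refl ⊚ idem ⟩
  c A I ∘ (c I A ∙[ p ] c I A) ≋⟨ ∙-assoc {p = refl} {q = p} ⟩
  (c A I ∘ c I A) ∙[ p ] c I A ≋⟨ ∙-cong ⟪ c-inv I A ⟫ ≋-refl ⟩
  𝟏 A ∙[ p ] c I A ≋⟨ ∙-idˡ {p = p} ⟩
  c I A ∎)
  where
  p : A ⊗ I ≡ A
  p = ⊗-unitʳ A
  q : A ⊗ I ≡ (I ⊗ A) ⊗ I
  q = refl
  idem : c I A ≋ c I A ∙[ p ] c I A
  idem =
    c I A ≋⟨ c-hex-≋ I I A q ⟩
    (c I A ▷ I) ∙[ q ] (I ◁ c I A) ≋⟨ ∙-cong (⊗-unitʳ-≋ _) ⟪ ⊗t-unitˡ _ ⟫ ⟩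
    c I A ∙[ p ] c I A ∎

c-Iʳ : ∀ A → c A I ≋ 𝟏 A
c-Iʳ A =
  c A I ≈˘⟨ idʳ _ ⟩
  c A I ∘ 𝟏 (A ⊗ I) ≋⟨ ≋-refl ⊚ ≋-trans (𝟏≋ (⊗-unitʳ A)) (≋-sym (c-I A)) ⟩
  c A I ∘ c I A ≈⟨ c-inv I A ⟩
  𝟏 A ∎

-- The symmetry with the rest of the context built in: both hexagons then become equations between
-- composites of `σ` and `◁` on right-nested contexts.
σ : ∀ A B X → Tm (A ⊗ B ⊗ X) (B ⊗ A ⊗ X)
σ A B X = cast (⊗-assoc A B X) (⊗-assoc B A X) (c A B ▷ X)

σ-≋ : ∀ A B X → σ A B X ≋ c A B ▷ X
σ-≋ A B X = cast-≋ (⊗-assoc A B X) (⊗-assoc B A X) _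

σ-nat : (f : Tm A A') (g : Tm B B') (h : Tm X Y) →
        σ A' B' Y ∘ (f ⊗t g ⊗t h) ≈ (g ⊗t f ⊗t h) ∘ σ A B X
σ-nat {A} {A'} {B} {B'} {X} {Y} f g h = ≋⇒≈ (
  σ A' B' Y ∘ (f ⊗t g ⊗t h) ≋⟨ σ-≋ A' B' Y ⊚ ≋-sym (⊗-assoc-≋ f g h) ⟩
  (c A' B' ▷ Y) ∘ ((f ⊗t g) ⊗t h) ≈⟨ ⊗-∘ _ _ _ _ ⟩
  (c A' B' ∘ (f ⊗t g)) ⊗t (𝟏 Y ∘ h) ≈⟨ ⊗-cong (c-nat f g) (idˡ h ⨾≈ ≈-sym (idʳ h)) ⟩
  ((g ⊗t f) ∘ c A B) ⊗t (h ∘ 𝟏 X) ≈˘⟨ ⊗-∘ _ _ _ _ ⟩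
  ((g ⊗t f) ⊗t h) ∘ (c A B ▷ X) ≋⟨ ⊗-assoc-≋ g f h ⊚ ≋-sym (σ-≋ A B X) ⟩
  (g ⊗t f ⊗t h) ∘ σ A B X ∎)

σ-inv : ∀ A B X → σ B A X ∘ σ A B X ≈ 𝟏 (A ⊗ B ⊗ X)
σ-inv A B X = ≋⇒≈ (
  σ B A X ∘ σ A B X ≋⟨ σ-≋ B A X ⊚ σ-≋ A B X ⟩
  (c B A ▷ X) ∘ (c A B ▷ X) ≈˘⟨ ▷-∘ _ _ ⟩
  (c B A ∘ c A B) ▷ X ≈⟨ ⊗-cong (c-inv A B) ≈-refl ⟩
  𝟏 (A ⊗ B) ⊗t 𝟏 X ≈⟨ ⊗-id _ _ ⟩
  𝟏 _ ≋⟨ 𝟏≋ (⊗-assoc A B X) ⟩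
  𝟏 _ ∎)

σ-I : ∀ B X → σ I B X ≋ 𝟏 (B ⊗ X)
σ-I B X =
  σ I B X ≋⟨ σ-≋ I B X ⟩
  c I B ▷ X ≋⟨ c-I B ⊠ ≋-refl ⟩
  𝟏 B ⊗t 𝟏 X ≈⟨ ⊗-id _ _ ⟩
  𝟏 _ ∎

σ-Iʳ : ∀ B X → σ B I X ≋ 𝟏 (B ⊗ X)
σ-Iʳ B X =
  σ B I X ≋⟨ σ-≋ B I X ⟩
  c B I ▷ X ≋⟨ c-Iʳ B ⊠ ≋-refl ⟩
  𝟏 B ⊗t 𝟏 X ≈⟨ ⊗-id _ _ ⟩
  𝟏 _ ∎

▷-∙ : {g : Tm B' C} {p : B ≡ B'} {f : Tm A B} (q : B ⊗ X ≡ B' ⊗ X) →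
      (g ∙[ p ] f) ▷ X ≋ (g ▷ X) ∙[ q ] (f ▷ X)
▷-∙ {p = refl} refl = ⟪ ▷-∘ _ _ ⟫

◁-∙ : {g : Tm B' C} {p : B ≡ B'} {f : Tm A B} (q : X ⊗ B ≡ X ⊗ B') →
      X ◁ (g ∙[ p ] f) ≋ (X ◁ g) ∙[ q ] (X ◁ f)
◁-∙ {p = refl} refl = ⟪ ◁-∘ _ _ ⟫

σ-⊗ : ∀ A B C X →
      σ (A ⊗ B) C X ≋ σ A C (B ⊗ X) ∘ (A ◁ σ B C X)
σ-⊗ A B C X =
  σ (A ⊗ B) C X ≋⟨ σ-≋ (A ⊗ B) C X ⟩
  c (A ⊗ B) C ▷ X ≋⟨ c-hex-≋ A B C q ⊠ ≋-refl ⟩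
  ((c A C ▷ B) ∙[ q ] (A ◁ c B C)) ▷ X ≋⟨ ▷-∙ (cong (_⊗ X) q) ⟩
  (c A C ▷ B ▷ X) ∙[ cong (_⊗ X) q ] ((A ◁ c B C) ▷ X)
    ≋⟨ ∙≋ (≋-trans (▷▷ _) (≋-sym (σ-≋ A C _))) (≋-trans (◁▷ _) (≋-refl ⊠ ≋-sym (σ-≋ B C X))) ⟩
  σ A C (B ⊗ X) ∘ (A ◁ σ B C X) ∎
  where
  q : A ⊗ (C ⊗ B) ≡ (A ⊗ C) ⊗ B
  q = sym (⊗-assoc A C B)

inverse-unique : {f : Tm A B} {g g' : Tm B A} → g ∘ f ≈ 𝟏 A → f ∘ g' ≈ 𝟏 B → g ≈ g'
inverse-unique {f = f} {g} {g'} e e' =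
  ≈-sym (idʳ g) ⨾≈ ∘-cong ≈-refl (≈-sym e') ⨾≈ ∘-assoc _ _ _ ⨾≈ ∘-cong e ≈-refl ⨾≈ idˡ g'

cancelʳ : {g : Tm B C} {f : Tm A B} {f' : Tm B A} {h : Tm A C} → f ∘ f' ≈ 𝟏 B → h ≈ g ∘ f → h ∘ f' ≈ g
cancelʳ e e' = ∘-cong e' ≈-refl ⨾≈ ≈-sym (∘-assoc _ _ _) ⨾≈ ∘-cong ≈-refl e ⨾≈ idʳ _

∘-inverse : {f : Tm A B} {f' : Tm B A} {g : Tm B C} {g' : Tm C B} →
            f' ∘ f ≈ 𝟏 A → g' ∘ g ≈ 𝟏 B → (f' ∘ g') ∘ (g ∘ f) ≈ 𝟏 A
∘-inverse e e' = ≈-sym (∘-assoc _ _ _) ⨾≈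
  ∘-cong ≈-refl (∘-assoc _ _ _ ⨾≈ ∘-cong e' ≈-refl ⨾≈ idˡ _) ⨾≈ e

◁-𝟏 : {f : Tm B B} → f ≈ 𝟏 B → A ◁ f ≈ 𝟏 (A ⊗ B)
◁-𝟏 e = ⊗-cong ≈-refl e ⨾≈ ⊗-id _ _

-- The second hexagon, obtained from the first by taking inverses.
σ-⊗ʳ : ∀ A B C X → σ A (B ⊗ C) X ≋ (B ◁ σ A C X) ∘ σ A B (C ⊗ X)
σ-⊗ʳ A B C X = ≋-trans (≋-sym (cast-≋ p q (σ A (B ⊗ C) X))) ⟪ inverse-unique l r ⟫
  where
  p : A ⊗ (B ⊗ C) ⊗ X ≡ A ⊗ B ⊗ C ⊗ X
  p = cong (A ⊗_) (⊗-assoc B C X)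
  q : (B ⊗ C) ⊗ A ⊗ X ≡ B ⊗ C ⊗ A ⊗ X
  q = ⊗-assoc B C (A ⊗ X)
  f : Tm (B ⊗ C ⊗ A ⊗ X) (A ⊗ B ⊗ C ⊗ X)
  f = σ B A (C ⊗ X) ∘ (B ◁ σ C A X)
  l : cast p q (σ A (B ⊗ C) X) ∘ f ≈ 𝟏 _
  l = ≋⇒≈ (
    cast p q (σ A (B ⊗ C) X) ∘ f ≋⟨ cast-≋ p q _ ⊚ ≋-sym (σ-⊗ B C A X) ⟩
    σ A (B ⊗ C) X ∘ σ (B ⊗ C) A X ≈⟨ σ-inv _ _ _ ⟩
    𝟏 _ ≋⟨ 𝟏≋ q ⟩
    𝟏 _ ∎)
  r : f ∘ ((B ◁ σ A C X) ∘ σ A B (C ⊗ X)) ≈ 𝟏 _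
  r = ∘-inverse (σ-inv A B (C ⊗ X)) (≈-sym (◁-∘ _ _) ⨾≈ ◁-𝟏 (σ-inv A C X))

-- Left rules act only at the head of the context; conjugation by `σ` brings there a rule that acts
-- behind the block `A`.
slide : ∀ A (φ : Tm D C) X → A ◁ (φ ▷ X) ≈ σ C A X ∘ (φ ▷ (A ⊗ X)) ∘ σ A D X
slide {D} {C} A φ X = ≋⇒≈ (
  A ◁ (φ ▷ X) ≈˘⟨ ∘-cong (σ-inv A C X) ≈-refl ⨾≈ idˡ _ ⟩
  (σ C A X ∘ σ A C X) ∘ (A ◁ (φ ▷ X)) ≈˘⟨ ∘-assoc _ _ _ ⟩
  σ C A X ∘ σ A C X ∘ (A ◁ (φ ▷ X)) ≈⟨ ∘-cong ≈-refl (σ-nat (𝟏 A) φ (𝟏 X)) ⟩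
  σ C A X ∘ (φ ⊗t 𝟏 A ⊗t 𝟏 X) ∘ σ A D X ≈⟨ ∘-cong ≈-refl (∘-cong (⊗-cong ≈-refl (⊗-id A X)) ≈-refl) ⟩
  σ C A X ∘ (φ ▷ (A ⊗ X)) ∘ σ A D X ∎)

σ-▷ : ∀ A B X Y → σ A B X ▷ Y ≋ σ A B (X ⊗ Y)
σ-▷ A B X Y =
  σ A B X ▷ Y ≋⟨ σ-≋ A B X ⊠ ≋-refl ⟩
  c A B ▷ X ▷ Y ≋⟨ ▷▷ _ ⟩
  c A B ▷ (X ⊗ Y) ≋˘⟨ σ-≋ A B (X ⊗ Y) ⟩
  σ A B (X ⊗ Y) ∎

σ-natˡ : ∀ (f : Tm A A') B X → σ A' B X ∘ (f ▷ (B ⊗ X)) ≈ (B ◁ (f ▷ X)) ∘ σ A B X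
σ-natˡ f B X = ∘-cong ≈-refl (⊗-cong ≈-refl (≈-sym (⊗-id B X))) ⨾≈ σ-nat f (𝟏 B) (𝟏 X)

σ-natᵐ : ∀ A (g : Tm B B') X → σ A B' X ∘ (A ◁ (g ▷ X)) ≈ (g ▷ (A ⊗ X)) ∘ σ A B X
σ-natᵐ A g X = σ-nat (𝟏 A) g (𝟏 X) ⨾≈ ∘-cong (⊗-cong ≈-refl (⊗-id A X)) ≈-refl

σ-natʳ : ∀ A B (h : Tm X Y) → σ A B Y ∘ (A ◁ B ◁ h) ≈ (B ◁ A ◁ h) ∘ σ A B X
σ-natʳ A B h = σ-nat (𝟏 A) (𝟏 B) h

-- Permutations

data Perm : Fm → Fm → Set where
  ↭-refl  : Perm Γ Γ
  ↭-prep  : ∀ a → Perm Γ Δ → Perm (a ∷ Γ) (a ∷ Δ)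
  ↭-swap  : ∀ a b Γ → Perm (a ∷ b ∷ Γ) (b ∷ a ∷ Γ)
  ↭-trans : Perm Γ Δ → Perm Δ A → Perm Γ A

⟦_⟧ : Perm Γ Δ → Tm Γ Δ
⟦ ↭-refl ⟧ = 𝟏 _
⟦ ↭-prep a π ⟧ = [ a ] ◁ ⟦ π ⟧
⟦ ↭-swap a b Γ ⟧ = σ [ a ] [ b ] Γ
⟦ ↭-trans π ρ ⟧ = ⟦ ρ ⟧ ∘ ⟦ π ⟧

-- Exchange in cut-free proofs is generated by adjacent swaps. Working up to `≈` lets block
-- symmetries count as exchanges too.
IsPerm : Tm Γ Δ → Set
IsPerm {Γ} {Δ} f = Σ (Perm Γ Δ) λ π → ⟦ π ⟧ ≈ f

isPerm-resp : {f : Tm A B} {g : Tm A' B'} → f ≋ g → IsPerm f → IsPerm g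
isPerm-resp ⟪ e ⟫ (π , e') = π , ≈-trans e' e

isPerm-𝟏 : ∀ A → IsPerm (𝟏 A)
isPerm-𝟏 A = ↭-refl , ≈-refl

isPerm-∘ : {g : Tm B C} {f : Tm A B} → IsPerm g → IsPerm f → IsPerm (g ∘ f)
isPerm-∘ (π , e) (ρ , e') = ↭-trans ρ π , ∘-cong e e'

isPerm-∷ : ∀ a {f : Tm A B} → IsPerm f → IsPerm ([ a ] ◁ f)
isPerm-∷ a (π , e) = ↭-prep a π , ⊗-cong ≈-refl e

isPerm-◁ : ∀ X {f : Tm A B} → IsPerm f → IsPerm (X ◁ f)
isPerm-◁ I p = isPerm-resp ⟪ ≈-sym (⊗t-unitˡ _) ⟫ p
isPerm-◁ (a ∷ X) p = isPerm-resp (≋-sym (◁◁ _)) (isPerm-∷ a (isPerm-◁ X p))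

isPerm-▷ : ∀ X {f : Tm A B} → IsPerm f → IsPerm (f ▷ X)
isPerm-▷ X (π , e) = isPerm-resp ⟪ ⊗-cong e ≈-refl ⟫ (go π)
  where
  go : (π : Perm Γ Δ) → IsPerm (⟦ π ⟧ ▷ X)
  go ↭-refl = isPerm-resp ⟪ ≈-sym (⊗-id _ _) ⟫ (isPerm-𝟏 _)
  go (↭-prep a π) = isPerm-resp (≋-sym (◁▷ _)) (isPerm-∷ a (go π))
  go (↭-swap a b Γ) = ↭-swap a b (Γ ⊗ X) , ≋⇒≈ (≋-sym (σ-▷ [ a ] [ b ] Γ X))
  go (↭-trans π ρ) = isPerm-resp ⟪ ≈-sym (▷-∘ _ _) ⟫ (isPerm-∘ (go ρ) (go π))

-- The two hexagons peel off one factor of either block at a time, down to adjacent swaps.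
isPerm-σ : ∀ A B X → IsPerm (σ A B X)
isPerm-σ I B X = isPerm-resp (≋-sym (σ-I B X)) (isPerm-𝟏 _)
isPerm-σ (a ∷ A) B X =
  isPerm-resp (≋-sym (σ-⊗ [ a ] A B X)) (isPerm-∘ (go B (A ⊗ X)) (isPerm-∷ a (isPerm-σ A B X)))
  where
  go : ∀ B X → IsPerm (σ [ a ] B X)
  go I X = isPerm-resp (≋-sym (σ-Iʳ [ a ] X)) (isPerm-𝟏 _)
  go (b ∷ B) X = isPerm-resp (≋-sym (σ-⊗ʳ [ a ] [ b ] B X))
    (isPerm-∘ (isPerm-∷ b (go B X)) (↭-swap a b (B ⊗ X) , ≈-refl))

isPerm-c : ∀ A B → IsPerm (c A B)
isPerm-c A B = isPerm-resp (≋-trans (σ-≋ A B I) (⊗-unitʳ-≋ _)) (isPerm-σ A B I)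

perm-sym : Perm Γ Δ → Perm Δ Γ
perm-sym ↭-refl = ↭-refl
perm-sym (↭-prep a π) = ↭-prep a (perm-sym π)
perm-sym (↭-swap a b Γ) = ↭-swap b a Γ
perm-sym (↭-trans π ρ) = ↭-trans (perm-sym ρ) (perm-sym π)

perm-inv : (π : Perm Γ Δ) → ⟦ perm-sym π ⟧ ∘ ⟦ π ⟧ ≈ 𝟏 Γ
perm-inv ↭-refl = idˡ _
perm-inv (↭-prep a π) = ≈-sym (◁-∘ _ _) ⨾≈ ◁-𝟏 (perm-inv π)
perm-inv (↭-swap a b Γ) = σ-inv [ a ] [ b ] Γ
perm-inv (↭-trans π ρ) = ∘-inverse (perm-inv π) (perm-inv ρ)

-- Cut elimination

curry : ∀ A B → Tm (A ⊗ B) C → Tm B (A ⊸ C)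
curry A B f = (A ⇒t f) ∘ η A B

uncurry : Tm B (A ⊸ C) → Tm (A ⊗ B) C
uncurry {B} {A} {C} g = ε A C ∘ (A ◁ g)

curry-uncurry : (g : Tm B (A ⊸ C)) → curry A B (uncurry g) ≈ g
curry-uncurry {B} {A} {C} g =
  ∘-cong (⇒-∘ A _ _) ≈-refl ⨾≈ ≈-sym (∘-assoc _ _ _) ⨾≈ ∘-cong ≈-refl (≈-sym (η-nat A g)) ⨾≈
  ∘-assoc _ _ _ ⨾≈ ∘-cong (tri₂ A C) ≈-refl ⨾≈ idˡ g

curry-cong : ∀ {A B C} {f f' : Tm (A ⊗ B) C} → f ≈ f' → curry A B f ≈ curry A B f'
curry-cong {A} {B} e = ∘-cong (⇒-cong e) ≈-refl

curry-nat : (f : Tm (A ⊗ B) C) (g : Tm D B) → curry A D (f ∘ (A ◁ g)) ≈ curry A B f ∘ g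
curry-nat {A} f g = ∘-cong (⇒-∘ A _ _) ≈-refl ⨾≈ ≈-sym (∘-assoc _ _ _) ⨾≈
  ∘-cong ≈-refl (≈-sym (η-nat A g)) ⨾≈ ∘-assoc _ _ _

uncurry-curry : (f : Tm (A ⊗ B) C) → ε A C ∘ (A ◁ curry A B f) ≈ f
uncurry-curry {A} {B} {C} f =
  ∘-cong ≈-refl (◁-∘ _ _) ⨾≈ ∘-assoc _ _ _ ⨾≈ ∘-cong (ε-nat A f) ≈-refl ⨾≈ ≈-sym (∘-assoc _ _ _) ⨾≈
  ∘-cong ≈-refl (tri₁ A B) ⨾≈ idʳ f

-- The left rule for implication without its continuation. The principal implication stands at the
-- head, so that the context of the rule computes to a cons; the symmetry carries it behind its
-- argument.
fire : Tm Γ A → Tm ((A ⇒ C) ∷ Γ) C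
fire {Γ} {A} {C} p = ε A C ∘ (p ▷ (A ⊸ C)) ∘ c (A ⊸ C) Γ

fire-cong : {p q : Tm Γ A} → p ≈ q → fire {C = C} p ≈ fire q
fire-cong e = ∘-cong ≈-refl (∘-cong (⊗-cong e ≈-refl) ≈-refl)

fire-nat : (p : Tm Γ A) (q : Tm Δ Γ) → fire {C = C} (p ∘ q) ≈ fire p ∘ ([ A ⇒ C ] ◁ q)
fire-nat p q = ∘-cong ≈-refl (∘-cong (▷-∘ p q) ≈-refl ⨾≈ ≈-sym (∘-assoc _ _ _) ⨾≈
  ∘-cong ≈-refl (≈-sym (c-nat (𝟏 _) q)) ⨾≈ ∘-assoc _ _ _) ⨾≈ ∘-assoc _ _ _

fire-c : (p : Tm Γ A) → fire {C = C} p ∘ c Γ (A ⊸ C) ≈ ε A C ∘ (p ▷ (A ⊸ C))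
fire-c p = cancelʳ (c-inv _ _) (∘-assoc _ _ _)

-- Cut-free proofs, as a predicate on terms.  n-tens splits off only the first factor of the succedent:
-- this is what makes the interaction with arbitrary splittings manageable.
data CutFree : Tm Γ B → Set where
  n-resp : {f g : Tm Γ B} → f ≈ g → CutFree f → CutFree g
  n-perm : {f : Tm Δ B} (π : Perm Γ Δ) → CutFree f → CutFree (f ∘ ⟦ π ⟧)
  n-var  : ∀ p → CutFree (𝟏 [ var p ])
  n-unit : CutFree (𝟏 I)
  n-tens : ∀ {b} {f : Tm Γ [ b ]} {g : Tm Δ B} → CutFree f → CutFree g → CutFree (f ⊗t g)
  n-lam  : ∀ A Γ {C} {f : Tm (A ⊗ Γ) C} → CutFree f → CutFree (curry A Γ f)
  n-fire : {p : Tm Γ A} {k : Tm (C ⊗ Δ) B} → CutFree p → CutFree k → CutFree (k ∘ (fire p ▷ Δ))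

-- Closed predicates and computability

Pred : Fm → Set₁
Pred B = ∀ Γ → Tm Γ B → Set

record Closed {B} (Q : Pred B) : Set where
  field
    resp : {f g : Tm Γ B} → f ≈ g → Q Γ f → Q Γ g
    perm : {f : Tm Δ B} (π : Perm Γ Δ) → Q Δ f → Q Γ (f ∘ ⟦ π ⟧)
    fire-closed : {p : Tm Γ A} {k : Tm (C ⊗ Δ) B} → CutFree p → Q _ k → Q _ (k ∘ (fire p ▷ Δ))

  resp-≋ : {f : Tm Γ B} {g : Tm Δ B} → f ≋ g → Q Γ f → Q Δ g
  resp-≋ ⟪ e ⟫ = resp e

  isPerm : {f : Tm Δ B} {g : Tm Γ Δ} → IsPerm g → Q Δ f → Q Γ (f ∘ g)
  isPerm (π , e) q = resp (∘-cong ≈-refl e) (perm π q)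

open Closed

data Cl {B} (P : Pred B) : Pred B where
  base : {f : Tm Γ B} → P Γ f → Cl P Γ f
  cl-resp : {f g : Tm Γ B} → f ≈ g → Cl P Γ f → Cl P Γ g
  cl-perm : {f : Tm Δ B} (π : Perm Γ Δ) → Cl P Δ f → Cl P Γ (f ∘ ⟦ π ⟧)
  cl-fire : {p : Tm Γ A} {k : Tm (C ⊗ Δ) B} → CutFree p → Cl P _ k → Cl P _ (k ∘ (fire p ▷ Δ))

Cl-closed : {P : Pred B} → Closed (Cl P)
Cl-closed = record { resp = cl-resp ; perm = cl-perm ; fire-closed = cl-fire }

CutFree-closed : Closed {B} (λ Γ → CutFree)
CutFree-closed = record { resp = n-resp ; perm = n-perm ; fire-closed = n-fire }

module _ {P : Pred B} {D : Fm} {Q : Pred D} (Q-closed : Closed Q) where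

  -- Permutations and left rules act by precomposition, hence commute with postcomposition by `t`.
  -- These are the commuting conversions of cut elimination.
  bind : (t : Tm B D) → (∀ {Γ f} → P Γ f → Q Γ (t ∘ f)) → ∀ {Γ f} → Cl P Γ f → Q Γ (t ∘ f)
  bind t h (base p) = h p
  bind t h (cl-resp e q) = resp Q-closed (∘-cong ≈-refl e) (bind t h q)
  bind t h (cl-perm π q) = resp Q-closed (≈-sym (∘-assoc _ _ _)) (perm Q-closed π (bind t h q))
  bind t h (cl-fire n q) = resp Q-closed (≈-sym (∘-assoc _ _ _)) (fire-closed Q-closed n (bind t h q))

  bindˡ : (t : Tm (B ⊗ A) D) (g : Tm Δ A) → (∀ {Γ f} → P Γ f → Q (Γ ⊗ Δ) (t ∘ (f ⊗t g))) →
          ∀ {Γ f} → Cl P Γ f → Q (Γ ⊗ Δ) (t ∘ (f ⊗t g))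
  bindˡ t g h (base p) = h p
  bindˡ t g h (cl-resp e q) = resp Q-closed (∘-cong ≈-refl (⊗-cong e ≈-refl)) (bindˡ t g h q)
  bindˡ t g h (cl-perm {f = f} π q) =
    resp Q-closed
      (≈-sym (∘-assoc _ _ _) ⨾≈ ∘-cong ≈-refl (⊗-∘ _ _ _ _ ⨾≈ ⊗-cong ≈-refl (idʳ _)))
      (isPerm Q-closed (isPerm-▷ _ (π , ≈-refl)) (bindˡ t g h q))
  bindˡ {Δ = Δ} t g h (cl-fire {C = C} {Δ = Δ'} {p = p} {k} n q) =
    resp-≋ Q-closed
      (k' ∘ (fire p ▷ (Δ' ⊗ Δ)) ≋⟨ cast-≋ assoc refl _ ⊚ ≋-sym (▷▷ (fire p)) ⟩
       (t ∘ (k ⊗t g)) ∘ (fire p ▷ Δ' ▷ Δ) ≈˘⟨ ∘-assoc _ _ _ ⟩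
       t ∘ (k ⊗t g) ∘ (fire p ▷ Δ' ▷ Δ) ≈⟨ ∘-cong ≈-refl (⊗-∘ _ _ _ _ ⨾≈ ⊗-cong ≈-refl (idʳ _)) ⟩
       t ∘ ((k ∘ (fire p ▷ Δ')) ⊗t g) ∎)
      (fire-closed Q-closed n (resp-≋ Q-closed (≋-sym (cast-≋ assoc refl _)) (bindˡ t g h q)))
    where
    assoc : (C ⊗ Δ') ⊗ Δ ≡ C ⊗ Δ' ⊗ Δ
    assoc = ⊗-assoc C Δ' Δ
    k' : Tm (C ⊗ Δ' ⊗ Δ) D
    k' = cast assoc refl (t ∘ (k ⊗t g))

  -- Here a left rule sits behind the block `Δ`; `slide` brings it to the head, where `fire-closed`
  -- applies, and exchange undoes the move.
  bindʳ : (t : Tm (A ⊗ B) D) (g : Tm Δ A) → (∀ {Γ f} → P Γ f → Q (Δ ⊗ Γ) (t ∘ (g ⊗t f))) →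
          ∀ {Γ f} → Cl P Γ f → Q (Δ ⊗ Γ) (t ∘ (g ⊗t f))
  bindʳ t g h (base p) = h p
  bindʳ t g h (cl-resp e q) = resp Q-closed (∘-cong ≈-refl (⊗-cong ≈-refl e)) (bindʳ t g h q)
  bindʳ t g h (cl-perm π q) =
    resp Q-closed
      (≈-sym (∘-assoc _ _ _) ⨾≈ ∘-cong ≈-refl (⊗-∘ _ _ _ _ ⨾≈ ⊗-cong (idʳ _) ≈-refl))
      (isPerm Q-closed (isPerm-◁ _ (π , ≈-refl)) (bindʳ t g h q))
  bindʳ {Δ = Δ} t g h (cl-fire {Γ = Γ'} {A = A'} {C = C} {Δ = Δ'} {p = p} {k} n q) =
    resp Q-closed
      (≈-sym (∘-assoc _ _ _) ⨾≈ ≈-sym (∘-assoc _ _ _) ⨾≈ ∘-cong ≈-refl (≈-sym (slide Δ (fire p) Δ')) ⨾≈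
       ≈-sym (∘-assoc _ _ _) ⨾≈ ∘-cong ≈-refl (⊗-∘ _ _ _ _ ⨾≈ ⊗-cong (idʳ _) ≈-refl))
      (isPerm Q-closed (isPerm-σ Δ ((A' ⇒ C) ∷ Γ') Δ')
        (fire-closed Q-closed n (isPerm Q-closed (isPerm-σ C Δ Δ') (bindʳ t g h q))))

data Unit : Pred I where
  unit : Unit I (𝟏 I)

data Tens (P : Pred A) (Q : Pred B) : Pred (A ⊗ B) where
  tens : {f : Tm Γ A} {g : Tm Δ B} → P Γ f → Q Δ g → Tens P Q (Γ ⊗ Δ) (f ⊗t g)

-- Computability.  Tensors being positive, the predicate at B₁ ⊗ B₂ is closed under permutations and left
-- rules by means of Cl.
RF : ∀ B → Pred B
RA : ∀ b → Pred [ b ]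
RF I = Cl Unit
RF (b ∷ B) = Cl (Tens (RA b) (RF B))
RA (var p) Γ f = CutFree f
RA (A ⇒ C) Γ f = ∀ {Δ} {a : Tm Δ A} → RF A Δ a → RF C (Δ ⊗ Γ) (ε A C ∘ (a ⊗t f))

RF-closed : ∀ B → Closed (RF B)
RF-closed I = Cl-closed
RF-closed (b ∷ B) = Cl-closed

𝟏-bind : {Q : Pred B} → Closed Q → {f : Tm Γ B} → Q Γ (𝟏 B ∘ f) → Q Γ f
𝟏-bind Q-closed = resp Q-closed (idˡ _)

RF-⊗ : {f : Tm Γ A} {g : Tm Δ B} → RF A Γ f → RF B Δ g → RF (A ⊗ B) (Γ ⊗ Δ) (f ⊗t g)
RF-⊗ {A = I} {B = B} {g = g} r s = 𝟏-bind (RF-closed B) (bindˡ (RF-closed B) (𝟏 B) g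
  (λ { unit → resp (RF-closed B) (≈-sym (⊗t-unitˡ g) ⨾≈ ≈-sym (idˡ _)) s }) r)
RF-⊗ {A = a ∷ A} {B = B} {g = g} r s = 𝟏-bind Cl-closed (bindˡ Cl-closed (𝟏 _) g
  (λ { (tens r₁ r₂) → resp-≋ Cl-closed (≋-trans (≋-sym (⊗-assoc-≋ _ _ _)) ⟪ ≈-sym (idˡ _) ⟫) (base (tens r₁ (RF-⊗ r₂ s))) }) r)

-- Since `A ⊗ B` computes to a concatenation, the two halves of a computable term have to be
-- recovered by recursion on `A`, one factor at a time.
RF-split : ∀ A {h : Tm Γ (A ⊗ B)} → RF (A ⊗ B) Γ h → Cl (Tens (RF A) (RF B)) Γ h
RF-split I r = cl-resp (⊗t-unitˡ _) (base (tens (base unit) r))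
RF-split (a ∷ A) r = 𝟏-bind Cl-closed (bind Cl-closed (𝟏 _)
  (λ { (tens r₁ r₂) → cl-resp (≈-sym (idˡ _)) (𝟏-bind Cl-closed (bindʳ Cl-closed (𝟏 _) _
     (λ { (tens r₂₁ r₂₂) → resp-≋ Cl-closed (≋-trans (⊗-assoc-≋ _ _ _) ⟪ ≈-sym (idˡ _) ⟫)
       (base (tens (base (tens r₁ r₂₁)) r₂₂)) }) (RF-split A r₂))) }) r)

RA⇒RF : ∀ {b} {f : Tm Γ [ b ]} → RA b Γ f → RF [ b ] Γ f
RA⇒RF r = resp-≋ Cl-closed (⊗-unitʳ-≋ _) (base (tens r (base unit)))

-- A single factor is a tensor with `I`. The unit is stripped off, while the closure remains and is
-- consumed by a later bind.
RF⇒RA : ∀ {b} {f : Tm Γ [ b ]} → RF [ b ] Γ f → Cl (RA b) Γ f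
RF⇒RA r = 𝟏-bind Cl-closed (bind Cl-closed (𝟏 _)
  (λ { (tens r₁ r₂) → cl-resp (≈-sym (idˡ _)) (𝟏-bind Cl-closed (bindʳ Cl-closed (𝟏 _) _
     (λ { unit → resp-≋ Cl-closed (≋-trans (≋-sym (⊗-unitʳ-≋ _)) ⟪ ≈-sym (idˡ _) ⟫) (base r₁) }) r₂)) }) r)

-- Stated as closure under postcomposition, it makes cut, the case of `∘`, immediate. The adjunction
-- enters through `tri₁` for `η` and `ε-nat` for `⇒t`.
fundamental : (t : Tm A B) {f : Tm Γ A} → RF A Γ f → RF B Γ (t ∘ f)
fundamental (𝟏 A) r = resp (RF-closed A) (≈-sym (idˡ _)) r
fundamental (c A B) r = bind (RF-closed (B ⊗ A)) (c A B)
  (λ { (tens r₁ r₂) → resp (RF-closed (B ⊗ A)) (≈-sym (c-nat _ _))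
    (isPerm (RF-closed (B ⊗ A)) (isPerm-c _ _) (RF-⊗ r₂ r₁)) }) (RF-split A r)
fundamental (η A B) {f} r = RA⇒RF {b = A ⇒ (A ⊗ B)} λ {Δ} {a} s → resp (RF-closed (A ⊗ B))
  (≈-sym (idˡ _) ⨾≈ ∘-cong (≈-sym (tri₁ A B)) ≈-refl ⨾≈ ≈-sym (∘-assoc _ _ _) ⨾≈
   ∘-cong ≈-refl (⊗-∘ _ _ _ _ ⨾≈ ⊗-cong (idˡ _) ≈-refl)) (RF-⊗ s r)
fundamental (ε A B) r = bind (RF-closed B) (ε A B)
  (λ { (tens r₁ r₂) → bindʳ (RF-closed B) (ε A B) _ (λ {Γ} {f} (s : RA (A ⇒ B) Γ f) → s r₁) (RF⇒RA r₂) }) (RF-split A r)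
fundamental (_∘_ {B = B} {C = C} g f) r =
  resp (RF-closed C) (∘-assoc _ _ _) (fundamental g (fundamental f r))
fundamental (_⊗t_ {A₁ = A₁} {B₁ = B₁} {B₂ = B₂} f g) r = bind (RF-closed (B₁ ⊗ B₂)) (f ⊗t g)
  (λ { (tens r₁ r₂) → resp (RF-closed (B₁ ⊗ B₂)) (≈-sym (⊗-∘ _ _ _ _))
    (RF-⊗ (fundamental f r₁) (fundamental g r₂)) }) (RF-split A₁ r)
fundamental (_⇒t_ {B₁} {B₂} A f) r = bind Cl-closed (A ⇒t f)
  (λ {Γ} {g} (s : RA (A ⇒ B₁) Γ g) → RA⇒RF {b = A ⇒ B₂} λ r₁ → resp (RF-closed B₂)
     (∘-assoc _ _ _ ⨾≈ ∘-cong (≈-sym (ε-nat A f)) ≈-refl ⨾≈ ≈-sym (∘-assoc _ _ _) ⨾≈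
      ∘-cong ≈-refl (⊗-∘ _ _ _ _ ⨾≈ ⊗-cong (idˡ _) ≈-refl))
     (fundamental f (s r₁))) (RF⇒RA r)

-- Reflecting an implication reifies its argument, which becomes the minor premise of a left rule;
-- reifying an implication applies it to the reflected identity of its antecedent and abstracts.
reflectF : ∀ A → RF A A (𝟏 A)
reflectA : ∀ a → RA a [ a ] (𝟏 [ a ])
reifyF : ∀ A {f : Tm Γ A} → RF A Γ f → CutFree f
reifyA : ∀ a {f : Tm Γ [ a ]} → RA a Γ f → CutFree f

reflectF I = base unit
reflectF (a ∷ A) = cl-resp (⊗-id [ a ] A) (base (tens (reflectA a) (reflectF A)))

reflectA (var p) = n-var p
reflectA (A ⇒ C) {Δ} {a} r =
  resp (RF-closed C) (fire-c a)
    (isPerm (RF-closed C) (isPerm-c Δ (A ⊸ C)) (resp-≋ (RF-closed C) e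
      (fire-closed (RF-closed C) (reifyF A r) (resp-≋ (RF-closed C) (𝟏-cast (sym (⊗-unitʳ C))) (reflectF C)))))
  where
  𝟏-cast : ∀ {C C'} (p : C ≡ C') → 𝟏 C ≋ cast p refl (𝟏 C)
  𝟏-cast p = ≋-sym (cast-≋ p refl _)
  e : cast (sym (⊗-unitʳ C)) refl (𝟏 C) ∘ (fire a ▷ I) ≋ fire {C = C} a
  e = ≋-trans (cast-≋ (sym (⊗-unitʳ C)) refl (𝟏 C) ⊚ ⊗-unitʳ-≋ (fire a)) ⟪ idˡ _ ⟫

reifyF I r = 𝟏-bind CutFree-closed (bind CutFree-closed (𝟏 _) (λ { unit → n-resp (≈-sym (idˡ _)) n-unit }) r)
reifyF (a ∷ A) r = 𝟏-bind CutFree-closed (bind CutFree-closed (𝟏 _)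
  (λ { (tens r₁ r₂) → n-resp (≈-sym (idˡ _)) (n-tens (reifyA a r₁) (reifyF A r₂)) }) r)

reifyA (var p) r = r
reifyA (A ⇒ C) r = n-resp (curry-uncurry _) (n-lam A _ (reifyF C (r (reflectF A))))

normalise : (f : Tm A B) → CutFree f
normalise {A} {B} f = n-resp (idʳ f) (reifyF B (fundamental f (reflectF A)))

-- Interleavings

-- The two parts will be the two colours. They start as consecutive blocks, but exchange and left
-- rules in the proof of `g` interleave them.
data Split : Fm → Fm → Fm → Set where
  []    : Split I I I
  left  : ∀ {a} → Split Γ Γ₁ Γ₂ → Split (a ∷ Γ) (a ∷ Γ₁) Γ₂
  right : ∀ {a} → Split Γ Γ₁ Γ₂ → Split (a ∷ Γ) Γ₁ (a ∷ Γ₂)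

sort : Split Γ Γ₁ Γ₂ → Tm Γ (Γ₁ ⊗ Γ₂)
sort [] = 𝟏 I
sort (left {a = a} s) = [ a ] ◁ sort s
sort (right {Γ₁ = Γ₁} {Γ₂} {a} s) = σ [ a ] Γ₁ Γ₂ ∘ ([ a ] ◁ sort s)

appendˡ : ∀ C → Split Γ Γ₁ Γ₂ → Split (C ⊗ Γ) (C ⊗ Γ₁) Γ₂
appendˡ I s = s
appendˡ (a ∷ C) s = left (appendˡ C s)

appendʳ : ∀ C → Split Γ Γ₁ Γ₂ → Split (C ⊗ Γ) Γ₁ (C ⊗ Γ₂)
appendʳ I s = s
appendʳ (a ∷ C) s = right (appendʳ C s)

sort-appendˡ : ∀ C (s : Split Γ Γ₁ Γ₂) → sort (appendˡ C s) ≋ C ◁ sort s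
sort-appendˡ I s = ⟪ ≈-sym (⊗t-unitˡ _) ⟫
sort-appendˡ (a ∷ C) s = ≋-trans (≋-refl ⊠ sort-appendˡ C s) (≋-sym (◁◁ _))

sort-appendʳ : ∀ C (s : Split Γ Γ₁ Γ₂) → sort (appendʳ C s) ≈ σ C Γ₁ Γ₂ ∘ (C ◁ sort s)
sort-appendʳ {Γ₁ = Γ₁} {Γ₂} I s = ≋⇒≈ (
  sort s ≈˘⟨ idˡ _ ⟩
  𝟏 _ ∘ sort s ≋˘⟨ σ-I Γ₁ Γ₂ ⊚ ⟪ ⊗t-unitˡ _ ⟫ ⟩
  σ I Γ₁ Γ₂ ∘ (I ◁ sort s) ∎)
sort-appendʳ {Γ₁ = Γ₁} {Γ₂} (a ∷ C) s = ≋⇒≈ (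
  σ [ a ] Γ₁ (C ⊗ Γ₂) ∘ ([ a ] ◁ sort (appendʳ C s))
    ≈⟨ ∘-cong ≈-refl (⊗-cong ≈-refl (sort-appendʳ C s) ⨾≈ ◁-∘ _ _) ⟩
  σ [ a ] Γ₁ (C ⊗ Γ₂) ∘ ([ a ] ◁ σ C Γ₁ Γ₂) ∘ ([ a ] ◁ C ◁ sort s) ≈⟨ ∘-assoc _ _ _ ⟩
  (σ [ a ] Γ₁ (C ⊗ Γ₂) ∘ ([ a ] ◁ σ C Γ₁ Γ₂)) ∘ ([ a ] ◁ C ◁ sort s)
    ≋˘⟨ σ-⊗ [ a ] C Γ₁ Γ₂ ⊚ ◁◁ _ ⟩
  σ (a ∷ C) Γ₁ Γ₂ ∘ ((a ∷ C) ◁ sort s) ∎)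

split-left : Split Γ Γ₁ I → Γ ≡ Γ₁
split-left [] = refl
split-left (left s) = cong (_ ∷_) (split-left s)

split-right : Split Γ I Γ₂ → Γ ≡ Γ₂
split-right [] = refl
split-right (right s) = cong (_ ∷_) (split-right s)

sort-left : (s : Split Γ Γ₁ I) → sort s ≋ 𝟏 Γ
sort-left [] = ≋-refl
sort-left (left {Γ = Γ} {a = a} s) = ≋-trans (≋-refl ⊠ sort-left s) ⟪ ⊗-id [ a ] Γ ⟫

sort-right : (s : Split Γ I Γ₂) → sort s ≋ 𝟏 Γ
sort-right [] = ≋-refl
sort-right (right {Γ = Γ} {Γ₂ = Γ₂} {a = a} s) =
  σ [ a ] I Γ₂ ∘ ([ a ] ◁ sort s) ≋⟨ σ-Iʳ [ a ] Γ₂ ⊚ ≋-refl ⟩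
  𝟏 (a ∷ Γ₂) ∘ ([ a ] ◁ sort s) ≈⟨ idˡ _ ⟩
  [ a ] ◁ sort s ≋⟨ ≋-refl ⊠ sort-right s ⟩
  [ a ] ◁ 𝟏 Γ ≈⟨ ⊗-id [ a ] Γ ⟩
  𝟏 (a ∷ Γ) ∎

-- Each block is sorted separately, after which the two inner pieces change places.
mid : Split Δ₁ E₁ E₂ → Split Δ₂ F₁ F₂ → Tm (Δ₁ ⊗ Δ₂) (E₁ ⊗ F₁ ⊗ E₂ ⊗ F₂)
mid {E₁ = E₁} {E₂} {F₁ = F₁} {F₂} s₁ s₂ =
  (E₁ ◁ σ E₂ F₁ F₂) ∙[ ⊗-assoc E₁ E₂ (F₁ ⊗ F₂) ] (sort s₁ ⊗t sort s₂)

-- A view, so that matching on it turns the two parts themselves into concatenations.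
data AppendView (Δ₁ Δ₂ : Fm) : ∀ {Γ₁ Γ₂} → Split (Δ₁ ⊗ Δ₂) Γ₁ Γ₂ → Set where
  append : {s : Split (Δ₁ ⊗ Δ₂) (E₁ ⊗ F₁) (E₂ ⊗ F₂)} (s₁ : Split Δ₁ E₁ E₂) (s₂ : Split Δ₂ F₁ F₂) →
           sort s ≋ mid s₁ s₂ → AppendView Δ₁ Δ₂ s

appendView : ∀ Δ₁ {Δ₂} (s : Split (Δ₁ ⊗ Δ₂) Γ₁ Γ₂) → AppendView Δ₁ Δ₂ s
appendView {Γ₁} {Γ₂} I s = append [] s (≋-sym (
  mid [] s ≋⟨ ∙≋ (≋-trans ⟪ ⊗t-unitˡ _ ⟫ (σ-I Γ₁ Γ₂)) ⟪ ⊗t-unitˡ _ ⟫ ⟩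
  𝟏 _ ∘ sort s ≈⟨ idˡ _ ⟩
  sort s ∎))
appendView (a ∷ Δ₁) (left s) with appendView Δ₁ s
... | append {E₁ = E₁} {F₁} {E₂} {F₂} s₁ s₂ e = append (left s₁) s₂ (
  [ a ] ◁ sort s ≋⟨ ≋-refl ⊠ e ⟩
  [ a ] ◁ mid s₁ s₂ ≋⟨ ◁-∙ (cong (a ∷_) (⊗-assoc E₁ E₂ (F₁ ⊗ F₂))) ⟩
  _ ≋⟨ ∙-cong (≋-sym (◁◁ _)) (≋-sym (⊗-assoc-≋ _ _ _)) ⟩
  mid (left s₁) s₂ ∎)
-- The factor `a` has to pass `E₁` and `F₁`. The second hexagon separates the two moves, naturality
-- takes the first past the inner exchange, and the first hexagon joins `a` to `E₂`.
appendView (a ∷ Δ₁) (right s) with appendView Δ₁ s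
... | append {E₁ = E₁} {F₁} {E₂} {F₂} s₁ s₂ e = append (right s₁) s₂ (
  σ [ a ] (E₁ ⊗ F₁) (E₂ ⊗ F₂) ∘ ([ a ] ◁ sort s)
    ≋⟨ σ-⊗ʳ [ a ] E₁ F₁ (E₂ ⊗ F₂) ⊚ ≋-trans (≋-refl ⊠ e) (◁-∙ p) ⟩
  ((E₁ ◁ σ [ a ] F₁ (E₂ ⊗ F₂)) ∘ σ [ a ] E₁ (F₁ ⊗ E₂ ⊗ F₂))
     ∘ (([ a ] ◁ E₁ ◁ σ E₂ F₁ F₂) ∙[ p ] ([ a ] ◁ (sort s₁ ⊗t sort s₂)))
    ≋⟨ ∙-assoc {p = refl} {q = p} ⟩
  (((E₁ ◁ σ [ a ] F₁ (E₂ ⊗ F₂)) ∘ σ [ a ] E₁ (F₁ ⊗ E₂ ⊗ F₂)) ∘ ([ a ] ◁ E₁ ◁ σ E₂ F₁ F₂))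
     ∙[ p ] ([ a ] ◁ (sort s₁ ⊗t sort s₂))
    ≋⟨ ∙-cong ⟪ ≈-sym (∘-assoc _ _ _) ⨾≈ ∘-cong ≈-refl (σ-natʳ [ a ] E₁ _) ⨾≈ ∘-assoc _ _ _ ⨾≈
                ∘-cong (≈-sym (◁-∘ _ _)) ≈-refl ⟫ ≋-refl ⟩
  ((E₁ ◁ (σ [ a ] F₁ (E₂ ⊗ F₂) ∘ ([ a ] ◁ σ E₂ F₁ F₂))) ∘ σ [ a ] E₁ (E₂ ⊗ F₁ ⊗ F₂))
     ∙[ p ] ([ a ] ◁ (sort s₁ ⊗t sort s₂))
    ≋˘⟨ ∙-assoc {p = refl} {q = p} ⟩
  (E₁ ◁ (σ [ a ] F₁ (E₂ ⊗ F₂) ∘ ([ a ] ◁ σ E₂ F₁ F₂))) ∘ (σ [ a ] E₁ (E₂ ⊗ F₁ ⊗ F₂)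
     ∙[ p ] ([ a ] ◁ (sort s₁ ⊗t sort s₂)))
    ≋˘⟨ ∙≋ (≋-refl ⊠ σ-⊗ [ a ] E₂ F₁ F₂) r ⟩
  mid (right s₁) s₂ ∎)
  where
  p : a ∷ (E₁ ⊗ E₂) ⊗ F₁ ⊗ F₂ ≡ a ∷ E₁ ⊗ E₂ ⊗ F₁ ⊗ F₂
  p = cong (a ∷_) (⊗-assoc E₁ E₂ (F₁ ⊗ F₂))
  r : sort (right s₁) ⊗t sort s₂ ≋ σ [ a ] E₁ (E₂ ⊗ F₁ ⊗ F₂) ∙[ p ] ([ a ] ◁ (sort s₁ ⊗t sort s₂))
  r =
    (σ [ a ] E₁ E₂ ∘ ([ a ] ◁ sort s₁)) ⊗t sort s₂
      ≈˘⟨ ⊗-∘ _ _ _ _ ⨾≈ ⊗-cong ≈-refl (idˡ _) ⟩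
    (σ [ a ] E₁ E₂ ▷ (F₁ ⊗ F₂)) ∘ (([ a ] ◁ sort s₁) ⊗t sort s₂)
      ≋˘⟨ ∙≋ (≋-sym (σ-▷ [ a ] E₁ E₂ (F₁ ⊗ F₂))) (≋-sym (⊗-assoc-≋ _ _ _)) ⟩
    σ [ a ] E₁ (E₂ ⊗ F₁ ⊗ F₂) ∙[ p ] ([ a ] ◁ (sort s₁ ⊗t sort s₂)) ∎

-- These degenerate cases are the ones left once colours have emptied one of the four pieces: the
-- inner exchange disappears or moves all of `Δ₁`.
mid-left : (s₁ : Split Δ₁ E₁ I) (s₂ : Split Δ₂ F₁ F₂) → mid s₁ s₂ ≋ Δ₁ ◁ sort s₂
mid-left {E₁ = E₁} {F₁ = F₁} {F₂} s₁ s₂ with refl ← split-left s₁ =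
  mid s₁ s₂ ≋⟨ ∙≋ (≋-trans (≋-refl ⊠ σ-I F₁ F₂) ⟪ ⊗-id _ _ ⟫) (sort-left s₁ ⊠ ≋-refl) ⟩
  𝟏 _ ∘ (E₁ ◁ sort s₂) ≈⟨ idˡ _ ⟩
  E₁ ◁ sort s₂ ∎

mid-right : (s₁ : Split Δ₁ I E₂) (s₂ : Split Δ₂ F₁ F₂) → mid s₁ s₂ ≋ σ Δ₁ F₁ F₂ ∘ (Δ₁ ◁ sort s₂)
mid-right {E₂ = E₂} {F₁ = F₁} {F₂} s₁ s₂ with refl ← split-right s₁ =
  ∙≋ ⟪ ⊗t-unitˡ _ ⟫ (sort-right s₁ ⊠ ≋-refl)

mid-rightʳ : (s₁ : Split Δ₁ E₁ E₂) (s₂ : Split Δ₂ I F₂) → mid s₁ s₂ ≋ sort s₁ ▷ Δ₂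
mid-rightʳ {E₁ = E₁} {E₂ = E₂} {F₂ = F₂} s₁ s₂ with refl ← split-right s₂ =
  mid s₁ s₂ ≋⟨ ∙≋ (≋-trans (≋-refl ⊠ σ-Iʳ E₂ F₂) (≋-trans ⟪ ⊗-id _ _ ⟫ (𝟏≋ (sym (⊗-assoc E₁ E₂ F₂))))) (≋-refl ⊠ sort-right s₂) ⟩
  𝟏 _ ∘ (sort s₁ ▷ F₂) ≈⟨ idˡ _ ⟩
  sort s₁ ▷ F₂ ∎

record PermSplit (π : Perm Γ Δ) (s : Split Γ Γ₁ Γ₂) : Set where
  constructor permSplit
  field
    {Δ₁'} {Δ₂'} : Fm
    π₁ : Perm Γ₁ Δ₁'
    π₂ : Perm Γ₂ Δ₂'
    s' : Split Δ Δ₁' Δ₂'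
    commutes : sort s' ∘ ⟦ π ⟧ ≈ (⟦ π₁ ⟧ ⊗t ⟦ π₂ ⟧) ∘ sort s

-- A swap inside one part becomes a swap of that part; a swap across the parts changes only the
-- interleaving.
permute : (π : Perm Γ Δ) (s : Split Γ Γ₁ Γ₂) → PermSplit π s
permute ↭-refl s = permSplit ↭-refl ↭-refl s (idʳ _ ⨾≈ ≈-sym (idˡ _) ⨾≈ ∘-cong (≈-sym (⊗-id _ _)) ≈-refl)
permute (↭-prep a π) (left s) with permSplit π₁ π₂ s' e ← permute π s =
  permSplit (↭-prep a π₁) π₂ (left s') (≋⇒≈ (
    ([ a ] ◁ sort s') ∘ ([ a ] ◁ ⟦ π ⟧) ≈⟨ ≈-sym (◁-∘ _ _) ⨾≈ ⊗-cong ≈-refl e ⨾≈ ◁-∘ _ _ ⟩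
    ([ a ] ◁ (⟦ π₁ ⟧ ⊗t ⟦ π₂ ⟧)) ∘ ([ a ] ◁ sort s) ≋˘⟨ ⊗-assoc-≋ _ _ _ ⊚ ≋-refl ⟩
    (([ a ] ◁ ⟦ π₁ ⟧) ⊗t ⟦ π₂ ⟧) ∘ ([ a ] ◁ sort s) ∎))
permute (↭-prep a π) (right s) with permSplit {Δ₁'} {Δ₂'} π₁ π₂ s' e ← permute π s =
  permSplit π₁ (↭-prep a π₂) (right s') (≋⇒≈ (
    (σ [ a ] Δ₁' Δ₂' ∘ ([ a ] ◁ sort s')) ∘ ([ a ] ◁ ⟦ π ⟧)
      ≈⟨ ≈-sym (∘-assoc _ _ _) ⨾≈ ∘-cong ≈-refl (≈-sym (◁-∘ _ _) ⨾≈ ⊗-cong ≈-refl e ⨾≈ ◁-∘ _ _) ⨾≈ ∘-assoc _ _ _ ⟩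
    (σ [ a ] Δ₁' Δ₂' ∘ ([ a ] ◁ (⟦ π₁ ⟧ ⊗t ⟦ π₂ ⟧))) ∘ ([ a ] ◁ sort s)
      ≈⟨ ∘-cong (σ-nat _ _ _) ≈-refl ⨾≈ ≈-sym (∘-assoc _ _ _) ⟩
    (⟦ π₁ ⟧ ⊗t ([ a ] ◁ ⟦ π₂ ⟧)) ∘ (σ [ a ] _ _ ∘ ([ a ] ◁ sort s)) ∎))
permute (↭-swap a b Γ) (left (left {Γ₁ = Γ₁} {Γ₂} s)) =
  permSplit (↭-swap a b Γ₁) ↭-refl (left (left s)) (≋⇒≈ (
    ([ b ] ◁ [ a ] ◁ sort s) ∘ σ [ a ] [ b ] Γ ≈˘⟨ σ-natʳ [ a ] [ b ] (sort s) ⟩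
    σ [ a ] [ b ] (Γ₁ ⊗ Γ₂) ∘ ([ a ] ◁ [ b ] ◁ sort s) ≋˘⟨ σ-▷ [ a ] [ b ] Γ₁ Γ₂ ⊚ ≋-refl ⟩
    (σ [ a ] [ b ] Γ₁ ▷ Γ₂) ∘ ([ a ] ◁ [ b ] ◁ sort s) ∎))
permute (↭-swap a b Γ) (left (right {Γ₁ = Γ₁} {Γ₂} s)) =
  permSplit ↭-refl ↭-refl (right (left s)) (≋⇒≈ (
    (σ [ b ] (a ∷ Γ₁) Γ₂ ∘ ([ b ] ◁ [ a ] ◁ sort s)) ∘ σ [ a ] [ b ] Γ
      ≈⟨ ≈-sym (∘-assoc _ _ _) ⨾≈ ∘-cong (≋⇒≈ (σ-⊗ʳ [ b ] [ a ] Γ₁ Γ₂)) (≈-sym (σ-natʳ [ a ] [ b ] (sort s))) ⨾≈ ≈-sym (∘-assoc _ _ _) ⟩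
    ([ a ] ◁ σ [ b ] Γ₁ Γ₂) ∘ σ [ b ] [ a ] (Γ₁ ⊗ Γ₂) ∘ σ [ a ] [ b ] (Γ₁ ⊗ Γ₂) ∘ ([ a ] ◁ [ b ] ◁ sort s)
      ≈⟨ ∘-cong ≈-refl (∘-assoc _ _ _ ⨾≈ ∘-cong (σ-inv [ a ] [ b ] (Γ₁ ⊗ Γ₂)) ≈-refl ⨾≈ idˡ _) ⨾≈ ≈-sym (◁-∘ _ _) ⟩
    [ a ] ◁ (σ [ b ] Γ₁ Γ₂ ∘ ([ b ] ◁ sort s)) ≈˘⟨ ∘-cong (⊗-id (a ∷ Γ₁) (b ∷ Γ₂)) ≈-refl ⨾≈ idˡ _ ⟩
    _ ∎))
permute (↭-swap a b Γ) (right (left {Γ₁ = Γ₁} {Γ₂} s)) =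
  permSplit ↭-refl ↭-refl (left (right s)) (≋⇒≈ (
    ([ b ] ◁ (σ [ a ] Γ₁ Γ₂ ∘ ([ a ] ◁ sort s))) ∘ σ [ a ] [ b ] Γ
      ≈⟨ ∘-cong (◁-∘ _ _) ≈-refl ⨾≈ ≈-sym (∘-assoc _ _ _) ⨾≈ ∘-cong ≈-refl (≈-sym (σ-natʳ [ a ] [ b ] (sort s))) ⨾≈ ∘-assoc _ _ _ ⟩
    (([ b ] ◁ σ [ a ] Γ₁ Γ₂) ∘ σ [ a ] [ b ] (Γ₁ ⊗ Γ₂)) ∘ ([ a ] ◁ [ b ] ◁ sort s)
      ≋˘⟨ σ-⊗ʳ [ a ] [ b ] Γ₁ Γ₂ ⊚ ≋-refl ⟩
    σ [ a ] (b ∷ Γ₁) Γ₂ ∘ ([ a ] ◁ [ b ] ◁ sort s) ≈˘⟨ ∘-cong (⊗-id (b ∷ Γ₁) (a ∷ Γ₂)) ≈-refl ⨾≈ idˡ _ ⟩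
    _ ∎))
permute (↭-swap a b Γ) (right (right {Γ₁ = Γ₁} {Γ₂} s)) =
  permSplit ↭-refl (↭-swap a b Γ₂) (right (right s)) (≋⇒≈ (
    sort (right {a = b} (right {a = a} s)) ∘ σ [ a ] [ b ] Γ ≈⟨ ∘-cong (double b a) ≈-refl ⨾≈ ≈-sym (∘-assoc _ _ _) ⟩
    σ (b ∷ [ a ]) Γ₁ Γ₂ ∘ ([ b ] ◁ [ a ] ◁ sort s) ∘ σ [ a ] [ b ] Γ
      ≈⟨ ∘-cong ≈-refl (≈-sym (σ-natʳ [ a ] [ b ] (sort s))) ⨾≈ ∘-assoc _ _ _ ⟩
    (σ (b ∷ [ a ]) Γ₁ Γ₂ ∘ σ [ a ] [ b ] (Γ₁ ⊗ Γ₂)) ∘ ([ a ] ◁ [ b ] ◁ sort s)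
      ≋⟨ (≋-refl ⊚ σ-≋ [ a ] [ b ] (Γ₁ ⊗ Γ₂)) ⊚ ≋-refl ⟩
    (σ (b ∷ [ a ]) Γ₁ Γ₂ ∘ (c [ a ] [ b ] ▷ (Γ₁ ⊗ Γ₂))) ∘ ([ a ] ◁ [ b ] ◁ sort s)
      ≈⟨ ∘-cong (σ-natˡ (c [ a ] [ b ]) Γ₁ Γ₂) ≈-refl ⨾≈ ≈-sym (∘-assoc _ _ _) ⨾≈ ∘-cong ≈-refl (≈-sym (double a b)) ⟩
    (Γ₁ ◁ (c [ a ] [ b ] ▷ Γ₂)) ∘ sort (right {a = a} (right {a = b} s))
      ≋˘⟨ (≋-refl ⊠ σ-≋ [ a ] [ b ] Γ₂) ⊚ ≋-refl ⟩
    (Γ₁ ◁ σ [ a ] [ b ] Γ₂) ∘ sort (right {a = a} (right {a = b} s)) ∎))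
  where
  double : ∀ a b → sort (right {a = a} (right {a = b} s)) ≈ σ (a ∷ [ b ]) Γ₁ Γ₂ ∘ ([ a ] ◁ [ b ] ◁ sort s)
  double a b = ∘-cong ≈-refl (◁-∘ _ _) ⨾≈ ∘-assoc _ _ _ ⨾≈ ∘-cong (≈-sym (≋⇒≈ (σ-⊗ [ a ] [ b ] Γ₁ Γ₂))) ≈-refl
permute (↭-trans π ρ) s with permSplit π₁ π₂ s' e ← permute π s
  with permSplit ρ₁ ρ₂ s'' e' ← permute ρ s' =
  permSplit (↭-trans π₁ ρ₁) (↭-trans π₂ ρ₂) s''
    (∘-assoc _ _ _ ⨾≈ ∘-cong e' ≈-refl ⨾≈ ≈-sym (∘-assoc _ _ _) ⨾≈ ∘-cong ≈-refl e ⨾≈ ∘-assoc _ _ _ ⨾≈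
     ∘-cong (⊗-∘ _ _ _ _) ≈-refl)

sort-right-block : ∀ {x Δ₁} {s : Split (Δ₁ ⊗ Δ₂) F₁ (Δ₁ ⊗ F₂)} (s₁ : Split Δ₁ I Δ₁) (s₂ : Split Δ₂ F₁ F₂) →
                   sort s ≋ mid s₁ s₂ → sort (right {a = x} s) ≈ σ (x ∷ Δ₁) F₁ F₂ ∘ ((x ∷ Δ₁) ◁ sort s₂)
sort-right-block {x = x} {Δ₁} s₁ s₂ e =
  ∘-cong ≈-refl (⊗-cong ≈-refl (≋⇒≈ (≋-trans e (mid-right s₁ s₂)) ⨾≈ ≈-sym (sort-appendʳ Δ₁ s₂))) ⨾≈
  sort-appendʳ (x ∷ Δ₁) s₂

data SingleView (x : At) (Δ₁ Δ₂ : Fm) : ∀ {Γ} → Split (Δ₁ ⊗ Δ₂) [ x ] Γ → Set where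
  inˡ : {u : Split (Δ₁ ⊗ Δ₂) [ x ] (Y₁ ⊗ Y₂)} (u₁ : Split Δ₁ [ x ] Y₁) (u₂ : Split Δ₂ I Y₂) →
        sort u ≋ mid u₁ u₂ → SingleView x Δ₁ Δ₂ u
  inʳ : {u : Split (Δ₁ ⊗ Δ₂) [ x ] (Y₁ ⊗ Y₂)} (u₁ : Split Δ₁ I Y₁) (u₂ : Split Δ₂ [ x ] Y₂) →
        sort u ≋ mid u₁ u₂ → SingleView x Δ₁ Δ₂ u

singleView : ∀ {x} Δ₁ {Δ₂} (u : Split (Δ₁ ⊗ Δ₂) [ x ] Γ) → SingleView x Δ₁ Δ₂ u
singleView {Γ} {x} Δ₁ {Δ₂} u = go refl u (appendView Δ₁ u)
  where
  -- The index `[ x ]` is generalised because `E₁ ⊗ F₁ ≡ [ x ]` can be solved only after a case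
  -- split on `E₁`.
  go : ∀ {X Γ} (p : X ≡ [ x ]) (u : Split (Δ₁ ⊗ Δ₂) X Γ) → AppendView Δ₁ Δ₂ u →
       SingleView x Δ₁ Δ₂ (subst (λ X → Split (Δ₁ ⊗ Δ₂) X Γ) p u)
  go p u (append {E₁ = I} s₁ s₂ e) with refl ← p = inʳ s₁ s₂ e
  go p u (append {E₁ = a ∷ I} s₁ s₂ e) with refl ← p = inˡ s₁ s₂ e

literal : ∀ Γ Δ → Split (Γ ⊗ Δ) Γ Δ
literal I I = []
literal I (a ∷ Δ) = right (literal I Δ)
literal (a ∷ Γ) Δ = left (literal Γ Δ)

sort-literal : ∀ Γ Δ → sort (literal Γ Δ) ≈ 𝟏 (Γ ⊗ Δ)
sort-literal I Δ = ≋⇒≈ (sort-right (literal I Δ))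
sort-literal (a ∷ Γ) Δ = ◁-𝟏 (sort-literal Γ Δ)

-- Moving a left rule through a splitting

-- Here `v` sorts the conclusion and `u` the continuation of a left rule `φ`. Both come from the
-- sorting `t` of the untouched context, so bifunctoriality lets `φ` pass.
push : {φ : Tm D C} {t : Tm Δ (F₁ ⊗ F₂)} {u : Tm (C ⊗ Δ) ((C ⊗ F₁) ⊗ F₂)} {v : Tm (D ⊗ Δ) ((D ⊗ F₁) ⊗ F₂)} →
       u ≋ C ◁ t → v ≋ D ◁ t → u ∘ (φ ▷ Δ) ≈ (φ ▷ F₁ ▷ F₂) ∘ v
push {D} {C} {Δ} {F₁} {F₂} {φ} {t} {u} {v} e e' = ≋⇒≈ (
  u ∘ (φ ▷ Δ) ≋⟨ e ⊚ ≋-refl ⟩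
  (C ◁ t) ∘ (φ ▷ Δ) ≈˘⟨ ▷◁ φ t ⟩
  (φ ▷ (F₁ ⊗ F₂)) ∘ (D ◁ t) ≋˘⟨ ▷▷ φ ⊚ e' ⟩
  (φ ▷ F₁ ▷ F₂) ∘ v ∎)

push-σ : {φ : Tm D C} {t : Tm Δ (F₁ ⊗ F₂)} {u : Tm (C ⊗ Δ) (F₁ ⊗ C ⊗ F₂)} {v : Tm (D ⊗ Δ) (F₁ ⊗ D ⊗ F₂)} →
         u ≈ σ C F₁ F₂ ∘ (C ◁ t) → v ≈ σ D F₁ F₂ ∘ (D ◁ t) → u ∘ (φ ▷ Δ) ≈ (F₁ ◁ (φ ▷ F₂)) ∘ v
push-σ {F₁ = F₁} {F₂} {φ = φ} {t} e e' =
  ∘-cong e ≈-refl ⨾≈ ≈-sym (∘-assoc _ _ _) ⨾≈ ∘-cong ≈-refl (≈-sym (▷◁ φ t)) ⨾≈ ∘-assoc _ _ _ ⨾≈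
  ∘-cong (σ-natˡ φ F₁ F₂) ≈-refl ⨾≈ ≈-sym (∘-assoc _ _ _) ⨾≈ ∘-cong ≈-refl (≈-sym e')

fire-tensorˡ : {φ : Tm D C} {k : Tm (C ⊗ Δ) (B ⊗ B')} {k₁ : Tm (C ⊗ F₁) B} {k₂ : Tm F₂ B'} {t : Tm Δ (F₁ ⊗ F₂)}
            {u : Tm (C ⊗ Δ) ((C ⊗ F₁) ⊗ F₂)} {v : Tm (D ⊗ Δ) ((D ⊗ F₁) ⊗ F₂)} →
            u ≋ C ◁ t → v ≋ D ◁ t → k ≈ (k₁ ⊗t k₂) ∘ u →
            k ∘ (φ ▷ Δ) ≈ ((k₁ ∘ (φ ▷ F₁)) ⊗t k₂) ∘ v
fire-tensorˡ e e' e'' =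
  ∘-cong e'' ≈-refl ⨾≈ ≈-sym (∘-assoc _ _ _) ⨾≈ ∘-cong ≈-refl (push e e') ⨾≈ ∘-assoc _ _ _ ⨾≈
  ∘-cong (⊗-∘ _ _ _ _ ⨾≈ ⊗-cong ≈-refl (idʳ _)) ≈-refl

fire-tensorʳ : {φ : Tm D C} {k : Tm (C ⊗ Δ) (B ⊗ B')} {k₁ : Tm F₁ B} {k₂ : Tm (C ⊗ F₂) B'} {t : Tm Δ (F₁ ⊗ F₂)}
             {u : Tm (C ⊗ Δ) (F₁ ⊗ C ⊗ F₂)} {v : Tm (D ⊗ Δ) (F₁ ⊗ D ⊗ F₂)} →
             u ≈ σ C F₁ F₂ ∘ (C ◁ t) → v ≈ σ D F₁ F₂ ∘ (D ◁ t) → k ≈ (k₁ ⊗t k₂) ∘ u →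
             k ∘ (φ ▷ Δ) ≈ (k₁ ⊗t (k₂ ∘ (φ ▷ F₂))) ∘ v
fire-tensorʳ e e' e'' =
  ∘-cong e'' ≈-refl ⨾≈ ≈-sym (∘-assoc _ _ _) ⨾≈ ∘-cong ≈-refl (push-σ e e') ⨾≈ ∘-assoc _ _ _ ⨾≈
  ∘-cong (⊗-∘ _ _ _ _ ⨾≈ ⊗-cong (idʳ _) ≈-refl) ≈-refl

tensor-firedˡ : {f : Tm Δ₁ B} {g : Tm Δ₂ B'} {k : Tm (C ⊗ E₂) B} {φ : Tm E₁ C} {t : Tm Δ₁ (E₁ ⊗ E₂)}
             {k' : Tm (C ⊗ E₂ ⊗ Δ₂) (B ⊗ B')} {φ' : Tm A C} {v : Tm (Δ₁ ⊗ Δ₂) (A ⊗ E₂ ⊗ Δ₂)} →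
             f ≈ k ∘ (φ ▷ E₂) ∘ t → k' ≋ k ⊗t g → φ' ≋ φ → v ≋ t ▷ Δ₂ →
             f ⊗t g ≈ k' ∘ (φ' ▷ (E₂ ⊗ Δ₂)) ∘ v
tensor-firedˡ {Δ₂ = Δ₂} {E₂ = E₂} {f = f} {g} {k} {φ} {t} {k'} {φ'} {v} e ek eφ ev = ≋⇒≈ (
  f ⊗t g ≈⟨ ⊗-cong e (≈-sym (idʳ g)) ⨾≈ ≈-sym (⊗-∘ _ _ _ _) ⨾≈ ∘-cong ≈-refl (▷-∘ _ _) ⟩
  (k ⊗t g) ∘ (φ ▷ E₂ ▷ Δ₂) ∘ (t ▷ Δ₂) ≋˘⟨ ek ⊚ ≋-trans (eφ ⊠ ≋-refl) (≋-sym (▷▷ φ)) ⊚ ev ⟩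
  k' ∘ (φ' ▷ (E₂ ⊗ Δ₂)) ∘ v ∎)

tensor-firedʳ : {f : Tm Δ₁ B} {g : Tm Δ₂ B'} {k : Tm (C ⊗ F₂) B'} {φ : Tm F₁ C} {t : Tm Δ₂ (F₁ ⊗ F₂)}
             {v : Tm (Δ₁ ⊗ Δ₂) (F₁ ⊗ Δ₁ ⊗ F₂)} →
             g ≈ k ∘ (φ ▷ F₂) ∘ t → v ≈ σ Δ₁ F₁ F₂ ∘ (Δ₁ ◁ t) →
             f ⊗t g ≈ ((f ⊗t k) ∘ σ C Δ₁ F₂) ∘ (φ ▷ (Δ₁ ⊗ F₂)) ∘ v
tensor-firedʳ {Δ₁ = Δ₁} {F₂ = F₂} {f = f} {φ = φ} e ev =
  ⊗-cong (≈-sym (idʳ f)) e ⨾≈ ≈-sym (⊗-∘ _ _ _ _) ⨾≈ ∘-cong ≈-refl (◁-∘ _ _) ⨾≈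
  ∘-cong ≈-refl (∘-cong (slide Δ₁ φ F₂) ≈-refl) ⨾≈
  ∘-cong ≈-refl (≈-sym (∘-assoc _ _ _) ⨾≈ ∘-cong ≈-refl (≈-sym (∘-assoc _ _ _) ⨾≈ ∘-cong ≈-refl (≈-sym ev))) ⨾≈
  ∘-assoc _ _ _

curry-fired : {f : Tm (A ⊗ Γ) B} {k : Tm (C ⊗ A ⊗ Γ₂) B} {φ : Tm D C} {t : Tm Γ (D ⊗ Γ₂)} {w : Tm (A ⊗ Γ) (D ⊗ A ⊗ Γ₂)} →
           f ≈ k ∘ (φ ▷ (A ⊗ Γ₂)) ∘ w → w ≈ σ A D Γ₂ ∘ (A ◁ t) →
           curry A Γ f ≈ curry A (C ⊗ Γ₂) (k ∘ σ A C Γ₂) ∘ (φ ▷ Γ₂) ∘ t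
curry-fired {A = A} {Γ₂ = Γ₂} {φ = φ} {t} e ew =
  curry-cong (e ⨾≈ ∘-cong ≈-refl (∘-cong ≈-refl ew ⨾≈ ∘-assoc _ _ _ ⨾≈
    ∘-cong (≈-sym (σ-natᵐ A φ Γ₂)) ≈-refl ⨾≈ ≈-sym (∘-assoc _ _ _) ⨾≈ ∘-cong ≈-refl (≈-sym (◁-∘ _ _))) ⨾≈
    ∘-assoc _ _ _) ⨾≈ curry-nat _ _

-- The elimination `φ` was found in the continuation of another left rule `ψ`; it moves below `ψ`,
-- which joins the new continuation.
fire-firedᵏ : {k : Tm (C' ⊗ Δ) B} {k' : Tm (C ⊗ C' ⊗ F₂) B} {φ : Tm F₁ C} {ψ : Tm D C'} {t : Tm Δ (F₁ ⊗ F₂)}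
                 {u : Tm (C' ⊗ Δ) (F₁ ⊗ C' ⊗ F₂)} {v : Tm (D ⊗ Δ) (F₁ ⊗ D ⊗ F₂)} →
                 k ≈ k' ∘ (φ ▷ (C' ⊗ F₂)) ∘ u → u ≈ σ C' F₁ F₂ ∘ (C' ◁ t) → v ≈ σ D F₁ F₂ ∘ (D ◁ t) →
                 k ∘ (ψ ▷ Δ) ≈ (k' ∘ (C ◁ (ψ ▷ F₂))) ∘ (φ ▷ (D ⊗ F₂)) ∘ v
fire-firedᵏ e eu ev =
  ∘-cong e ≈-refl ⨾≈ ≈-sym (∘-assoc _ _ _) ⨾≈
  ∘-cong ≈-refl (≈-sym (∘-assoc _ _ _) ⨾≈ ∘-cong ≈-refl (push-σ eu ev) ⨾≈ ∘-assoc _ _ _ ⨾≈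
    ∘-cong (▷◁ _ _) ≈-refl ⨾≈ ≈-sym (∘-assoc _ _ _)) ⨾≈ ∘-assoc _ _ _

-- The elimination `φ` was found in the argument of another left rule. What is left of that
-- argument, `k'`, is the argument of the same rule inside the new continuation.
fire-firedᵖ : {p : Tm Δ₁ A} {k : Tm (C' ⊗ Δ₂) B} {k' : Tm (C ⊗ E₂) A} {φ : Tm E₁ C} {t : Tm Δ₁ (E₁ ⊗ E₂)}
                {k'' : Tm (C ⊗ (A ⊸ C') ⊗ E₂ ⊗ Δ₂) B} {φ' : Tm D C} {v : Tm ((A ⇒ C') ∷ Δ₁ ⊗ Δ₂) (D ⊗ (A ⊸ C') ⊗ E₂ ⊗ Δ₂)} →
                p ≈ k' ∘ (φ ▷ E₂) ∘ t → φ' ≋ φ →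
                k'' ≋ (k ∘ (fire k' ▷ Δ₂)) ∙[ cong ((A ⇒ C') ∷_) (sym (⊗-assoc C E₂ Δ₂)) ] σ C (A ⊸ C') (E₂ ⊗ Δ₂) →
                v ≋ σ (A ⊸ C') E₁ (E₂ ⊗ Δ₂) ∙[ cong ((A ⇒ C') ∷_) (⊗-assoc E₁ E₂ Δ₂) ] ((A ⊸ C') ◁ (t ▷ Δ₂)) →
                k ∘ (fire p ▷ Δ₂) ≈ k'' ∘ (φ' ▷ ((A ⊸ C') ⊗ E₂ ⊗ Δ₂)) ∘ v
fire-firedᵖ {Δ₁} {A} {C'} {Δ₂} {C = C} {E₂ = E₂} {E₁ = E₁} {D} {p} {k} {k'} {φ} {t} {k''} {φ'} {v} e eφ ek ev = ≋⇒≈ (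
  k ∘ (fire p ▷ Δ₂)
    ≈⟨ ∘-cong ≈-refl (⊗-cong (fire-cong e ⨾≈ fire-nat _ _) ≈-refl ⨾≈ ▷-∘ _ _) ⨾≈ ∘-assoc _ _ _ ⟩
  (k ∘ (fire k' ▷ Δ₂)) ∘ (y ◁ ((φ ▷ E₂) ∘ t) ▷ Δ₂)
    ≋⟨ ≋-refl ⊚ (≋-trans (◁▷ _) ⟪ ⊗-cong ≈-refl (▷-∘ _ _) ⨾≈ ◁-∘ _ _ ⟫) ⟩
  (k ∘ (fire k' ▷ Δ₂)) ∘ (y ◁ (φ ▷ E₂ ▷ Δ₂)) ∘ (y ◁ (t ▷ Δ₂))
    ≋˘⟨ ∙≋ {p = p₁} ≋-refl (∙≋ {p = p₂} (≋-refl ⊠ ≋-sym (▷▷ φ)) ≋-refl) ⟩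
  (k ∘ (fire k' ▷ Δ₂)) ∙[ p₁ ] (y ◁ (φ ▷ (E₂ ⊗ Δ₂))) ∙[ p₂ ] (y ◁ (t ▷ Δ₂))
    ≋⟨ ∙-cong {p' = p₁} ≋-refl (∙-cong {p' = p₂} ⟪ slide y φ (E₂ ⊗ Δ₂) ⟫ ≋-refl) ⟩
  (k ∘ (fire k' ▷ Δ₂)) ∙[ p₁ ] (σ C y (E₂ ⊗ Δ₂) ∘ (φ ▷ (y ⊗ E₂ ⊗ Δ₂)) ∘ σ y E₁ (E₂ ⊗ Δ₂)) ∙[ p₂ ] (y ◁ (t ▷ Δ₂))
    ≋˘⟨ ∙-cong {p = p₁} ≋-refl (≋-trans (≋-refl ⊚ ∙-assoc {p = refl} {q = p₂}) (∙-assoc {p = refl} {q = p₂})) ⟩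
  (k ∘ (fire k' ▷ Δ₂)) ∙[ p₁ ] σ C y (E₂ ⊗ Δ₂) ∘ (φ ▷ (y ⊗ E₂ ⊗ Δ₂)) ∘ σ y E₁ (E₂ ⊗ Δ₂) ∙[ p₂ ] (y ◁ (t ▷ Δ₂))
    ≋⟨ ∙-assoc {p = p₁} {q = refl} ⟩
  ((k ∘ (fire k' ▷ Δ₂)) ∙[ p₁ ] σ C y (E₂ ⊗ Δ₂)) ∘ (φ ▷ (y ⊗ E₂ ⊗ Δ₂)) ∘ σ y E₁ (E₂ ⊗ Δ₂) ∙[ p₂ ] (y ◁ (t ▷ Δ₂))
    ≋˘⟨ ek ⊚ (eφ ⊠ ≋-refl) ⊚ ev ⟩
  k'' ∘ (φ' ▷ (y ⊗ E₂ ⊗ Δ₂)) ∘ v ∎)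
  where
  y : Fm
  y = A ⊸ C'
  p₁ = cong ((A ⇒ C') ∷_) (sym (⊗-assoc C E₂ Δ₂))
  p₂ = cong ((A ⇒ C') ∷_) (⊗-assoc E₁ E₂ Δ₂)

-- When the result of `ψ` is consumed by the eliminated block, `ψ` moves into `φ`; `fire-absorb`
-- then moves it on into the argument.
fire-fired-absorb : {k : Tm (C' ⊗ Δ) B} {k' : Tm (C ⊗ F₂) B} {φ : Tm (C' ⊗ F₁) C} {ψ : Tm D C'} {t : Tm Δ (F₁ ⊗ F₂)}
                 {u : Tm (C' ⊗ Δ) ((C' ⊗ F₁) ⊗ F₂)} {v : Tm (D ⊗ Δ) ((D ⊗ F₁) ⊗ F₂)} →
                 k ≈ k' ∘ (φ ▷ F₂) ∘ u → u ≋ C' ◁ t → v ≋ D ◁ t →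
                 k ∘ (ψ ▷ Δ) ≈ k' ∘ ((φ ∘ (ψ ▷ F₁)) ▷ F₂) ∘ v
fire-fired-absorb e eu ev =
  ∘-cong e ≈-refl ⨾≈ ≈-sym (∘-assoc _ _ _) ⨾≈
  ∘-cong ≈-refl (≈-sym (∘-assoc _ _ _) ⨾≈ ∘-cong ≈-refl (push eu ev) ⨾≈ ∘-assoc _ _ _ ⨾≈ ∘-cong (≈-sym (▷-∘ _ _)) ≈-refl)

fire-absorb : {p : Tm (C' ⊗ Y) A} {φ : Tm (C' ⊗ X) C} {ψ : Tm D C'} {t : Tm X ((A ⇒ C) ∷ Y)}
              {u : Tm (C' ⊗ X) ((A ⇒ C) ∷ C' ⊗ Y)} {v : Tm (D ⊗ X) ((A ⇒ C) ∷ D ⊗ Y)} →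
              φ ≈ fire p ∘ u → u ≈ σ C' (A ⊸ C) Y ∘ (C' ◁ t) → v ≈ σ D (A ⊸ C) Y ∘ (D ◁ t) →
              φ ∘ (ψ ▷ X) ≈ fire (p ∘ (ψ ▷ Y)) ∘ v
fire-absorb e eu ev =
  ∘-cong e ≈-refl ⨾≈ ≈-sym (∘-assoc _ _ _) ⨾≈ ∘-cong ≈-refl (push-σ eu ev) ⨾≈ ∘-assoc _ _ _ ⨾≈
  ∘-cong (≈-sym (fire-nat _ _)) ≈-refl

-- Coloured sequents

data All (P : At → Set) : Fm → Set where
  []  : All P I
  _∷_ : ∀ {a} → P a → All P A → All P (a ∷ A)

all-map : (∀ {a} → P a → Q a) → All P A → All Q A
all-map f [] = []
all-map f (p ∷ ps) = f p ∷ all-map f ps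

all-⊗ : All P A → All P B → All P (A ⊗ B)
all-⊗ [] qs = qs
all-⊗ (p ∷ ps) qs = p ∷ all-⊗ ps qs

all-⊗⁻ : ∀ A → All P (A ⊗ B) → All P A × All P B
all-⊗⁻ I ps = [] , ps
all-⊗⁻ (a ∷ A) (p ∷ ps) with qs , rs ← all-⊗⁻ A ps = p ∷ qs , rs

all-perm : Perm Γ Δ → All P Γ → All P Δ
all-perm ↭-refl ps = ps
all-perm (↭-prep a π) (p ∷ ps) = p ∷ all-perm π ps
all-perm (↭-swap a b Γ) (p ∷ q ∷ ps) = q ∷ p ∷ ps
all-perm (↭-trans π ρ) ps = all-perm ρ (all-perm π ps)

all-unsplit : Split Γ Γ₁ Γ₂ → All P Γ₁ → All P Γ₂ → All P Γ
all-unsplit [] ps qs = []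
all-unsplit (left s) (p ∷ ps) qs = p ∷ all-unsplit s ps qs
all-unsplit (right s) ps (q ∷ qs) = q ∷ all-unsplit s ps qs

all-split : Split Γ Γ₁ Γ₂ → All P Γ → All P Γ₁ × All P Γ₂
all-split [] ps = [] , []
all-split (left s) (p ∷ ps) with qs , rs ← all-split s ps = p ∷ qs , rs
all-split (right s) (p ∷ ps) with qs , rs ← all-split s ps = qs , p ∷ rs

perm-I : (π : Perm I Δ) → ⟦ π ⟧ ≋ 𝟏 I
perm-I ↭-refl = ≋-refl
-- Abstracting `⟦ π ⟧` lets the match on `⟪ e ⟫` identify the middle context with `I`.
perm-I (↭-trans π ρ) with ⟦ π ⟧ | perm-I π
... | _ | ⟪ e ⟫ = ≋-trans (perm-I ρ ⊚ ⟪ e ⟫) ⟪ idˡ _ ⟫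

perm-singleton : (π : Perm [ x ] Δ) → ⟦ π ⟧ ≋ 𝟏 [ x ]
perm-singleton ↭-refl = ≋-refl
perm-singleton (↭-prep a π) = ≋-trans (≋-refl ⊠ perm-I π) ⟪ ⊗-id [ a ] I ⟫
perm-singleton (↭-trans π ρ) with ⟦ π ⟧ | perm-singleton π
... | _ | ⟪ e ⟫ = ≋-trans (perm-singleton ρ ⊚ ⟪ e ⟫) ⟪ idˡ _ ⟫

Tensor : Split Γ Γ₁ Γ₂ → Tm Γ (B ⊗ B') → Set
Tensor {Γ₁ = Γ₁} {Γ₂} {B} {B'} s h =
  Σ (Tm Γ₁ B) λ f → Σ (Tm Γ₂ B') λ g → h ≈ (f ⊗t g) ∘ sort s

tensor-I : ∀ {b} (s : Split Γ Γ₁ Γ₂) → Γ₂ ≡ I → (h : Tm Γ [ b ]) → Tensor {B = [ b ]} {B' = I} s h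
tensor-I s refl h with refl ← split-left s = h , 𝟏 I , ≋⇒≈ (
  h ≈˘⟨ idʳ h ⟩
  h ∘ 𝟏 _ ≋˘⟨ ⊗-unitʳ-≋ h ⊚ sort-left s ⟩
  (h ⊗t 𝟏 I) ∘ sort s ∎)

Fires : Split Γ [ A ⇒ C ] Γ₁ → Tm Γ C → Set
Fires {A = A} {Γ₁ = Γ₁} u φ = Σ (Tm Γ₁ A) λ p → φ ≈ fire p ∘ sort u

fires-resp : {u : Split Γ [ A ⇒ C ] Γ₁} {u' : Split Δ [ A ⇒ C ] Δ₁} {φ : Tm Γ C} {φ' : Tm Δ C} →
             sort u' ≋ sort u → φ' ≋ φ → Fires u φ → Fires u' φ'
fires-resp {u = u} {u' = u'} e e' f with sort u' | sort u | e
fires-resp e ⟪ e' ⟫ (p , e'') | _ | _ | ⟪ e₁ ⟫ = p , (e' ⨾≈ e'' ⨾≈ ∘-cong ≈-refl (≈-sym e₁))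

-- The implication marked by `u` will have antecedent of colour true and codomain of colour false,
-- so it fits neither colour. Its argument must use exactly the rest of `Δ`, and the continuation
-- sees only `C` and `Γ₂`.
Fired : Split Γ Δ Γ₂ → Split Δ [ A ⇒ C ] Γ₁ → Tm Γ B → Set
Fired {Δ = Δ} {Γ₂ = Γ₂} {C = C} {B = B} s u h =
  Σ (Tm Δ C) λ φ → Fires u φ × Σ (Tm (C ⊗ Γ₂) B) λ k → h ≈ k ∘ (φ ▷ Γ₂) ∘ sort s

module Coloured (colour : ℕ → Bool) where

  -- Reducedness is included so that a nonempty formula contains a letter; `I` alone has both
  -- colours.
  data GoodAt (b : Bool) : At → Set where
    gvar : ∀ {p} → colour p ≡ b → GoodAt b (var p)
    gimp : C ≢ I → All (GoodAt b) A → All (GoodAt b) C → GoodAt b (A ⇒ C)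

  Good : Bool → Fm → Set
  Good b = All (GoodAt b)

  Mixed : Fm → Set
  Mixed = All (λ a → Σ Bool λ b → GoodAt b a)

  mixed : ∀ {b} → Good b A → Mixed A
  mixed = all-map (_ ,_)

  -- Codomains are nonempty, so descending through them ends at a letter, and a letter has one
  -- colour.
  same-colour : ∀ {b b'} → A ≢ I → Good b A → Good b' A → b ≡ b'
  same-colour ne [] [] = ⊥-elim (ne refl)
  same-colour ne (gvar e ∷ _) (gvar e' ∷ _) = trans (sym e) e'
  same-colour ne (gimp ne' _ g ∷ _) (gimp _ _ g' ∷ _) = same-colour ne' g g'

  both-colours : Good true A → Good false A → A ≡ I
  both-colours [] _ = refl
  both-colours gs@(_ ∷ _) gs' with () ← same-colour (λ ()) gs gs'

  -- Axioms join equal colours, and at a left rule the continuation forces the colour of the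
  -- succedent on the codomain, hence on the whole implication and its argument. At succedent `I`
  -- both values of `b` are available, which leaves only the empty context.
  monochrome : ∀ {b} {h : Tm Γ B} → CutFree h → Mixed Γ → Good b B → Good b Γ
  monochrome (n-resp e n) m g = monochrome n m g
  monochrome (n-perm π n) m g = all-perm (perm-sym π) (monochrome n (all-perm π m) g)
  monochrome (n-var p) m g = g
  monochrome n-unit m g = []
  monochrome (n-tens {Γ = Γ} n₁ n₂) m (g ∷ gs) with m₁ , m₂ ← all-⊗⁻ Γ m =
    all-⊗ (monochrome n₁ m₁ (g ∷ [])) (monochrome n₂ m₂ gs)
  monochrome (n-lam A Γ n) m (gimp _ ga gc ∷ []) = proj₂ (all-⊗⁻ A (monochrome n (all-⊗ (mixed ga) m) gc))
  monochrome (n-fire {Γ = Γ} {C = C} n₁ n₂) ((b , g@(gimp ne ga gc)) ∷ m) gb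
    with m₁ , m₂ ← all-⊗⁻ Γ m
    with gc' , g₂ ← all-⊗⁻ C (monochrome n₂ (all-⊗ (mixed gc) m₂) gb)
    -- C has letters because C ≢ I; hence the implication has the colour of the succedent.
    with refl ← same-colour ne gc gc' = g ∷ all-⊗ (monochrome n₁ m₁ ga) g₂

  no-right : {h : Tm Γ B} → CutFree h → Split Γ Γ₁ Γ₂ → Good true Γ₁ → Good false Γ₂ → Good true B → Γ₂ ≡ I
  no-right n s g₁ g₂ g =
    both-colours (proj₂ (all-split s (monochrome n (all-unsplit s (mixed g₁) (mixed g₂)) g))) g₂

  no-left : {h : Tm Γ B} → CutFree h → Split Γ Γ₁ Γ₂ → Good true Γ₁ → Good false Γ₂ → Good false B → Γ₁ ≡ I
  no-left n s g₁ g₂ g =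
    both-colours g₁ (proj₁ (all-split s (monochrome n (all-unsplit s (mixed g₁) (mixed g₂)) g)))

  -- By monochrome the two colours never meet in a premise of a right rule or in the argument of a left
  -- rule, so the proof can be followed upwards until the succedent is split.
  tensor : ∀ {b} {h : Tm Γ (b ∷ B)} → CutFree h → (s : Split Γ Γ₁ Γ₂) → Good true Γ₁ → Good false Γ₂ →
           GoodAt true b → Good false B → Tensor {B = [ b ]} {B' = B} s h
  tensor (n-resp e n) s g₁ g₂ gb gB with f , g , e' ← tensor n s g₁ g₂ gb gB = f , g , (≈-sym e ⨾≈ e')
  tensor (n-perm π n) s g₁ g₂ gb gB with permSplit π₁ π₂ s' e ← permute π s
    with f , g , e' ← tensor n s' (all-perm π₁ g₁) (all-perm π₂ g₂) gb gB =
    f ∘ ⟦ π₁ ⟧ , g ∘ ⟦ π₂ ⟧ ,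
    (∘-cong e' ≈-refl ⨾≈ ≈-sym (∘-assoc _ _ _) ⨾≈ ∘-cong ≈-refl e ⨾≈ ∘-assoc _ _ _ ⨾≈
     ∘-cong (⊗-∘ _ _ _ _) ≈-refl)
  tensor n@(n-var p) s g₁ g₂ gb gB = tensor-I s (no-right n s g₁ g₂ (gb ∷ [])) _
  tensor n@(n-lam _ _ _) s g₁ g₂ gb gB = tensor-I s (no-right n s g₁ g₂ (gb ∷ [])) _
  tensor (n-tens {Γ = Δ₁} {b = b} {f = f} {g} n₁ n₂) s g₁ g₂ gb gB
    with appendView Δ₁ s
  ... | append {E₁ = E₁} {F₁} {E₂} {F₂} s₁ s₂ e
    with ge₁ , gf₁ ← all-⊗⁻ E₁ g₁ | ge₂ , gf₂ ← all-⊗⁻ E₂ g₂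
    -- Each premise keeps only its own colour, so the requested splitting is the one made by this
    -- rule.
    with refl ← no-right n₁ s₁ ge₁ ge₂ (gb ∷ []) | refl ← no-left n₂ s₂ gf₁ gf₂ gB
    with refl ← split-left s₁ | refl ← split-right s₂ =
    cast p refl f , g , ≋⇒≈ (
      f ⊗t g ≈˘⟨ idʳ _ ⟩
      (f ⊗t g) ∘ 𝟏 _ ≋˘⟨ (cast-≋ p refl f ⊠ ≋-refl) ⊚ ≋-trans e (≋-trans (mid-left s₁ s₂) (≋-trans (≋-refl ⊠ sort-right s₂) ⟪ ⊗-id _ _ ⟫)) ⟩
      (cast p refl f ⊗t g) ∘ sort s ∎)
    where
    p : E₁ ≡ E₁ ⊗ I
    p = sym (⊗-unitʳ E₁)
  tensor (n-fire {Γ = Δ₁} {A = A} {C = C} {p = p} n₁ n₂) (left s) (gimp ne ga gc ∷ g₁) g₂ gb gB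
    with appendView Δ₁ s
  ... | append {E₁ = E₁} {F₁} {E₂} {F₂} s₁ s₂ e
    with ge₁ , gf₁ ← all-⊗⁻ E₁ g₁ | ge₂ , gf₂ ← all-⊗⁻ E₂ g₂
    with refl ← no-right n₁ s₁ ge₁ ge₂ ga
    with refl ← split-left s₁
    with k₁ , k₂ , e' ← tensor n₂ (appendˡ C s₂) (all-⊗ gc gf₁) gf₂ gb gB =
    k₁ ∘ (fire p ▷ F₁) , k₂ ,
    fire-tensorˡ (sort-appendˡ C s₂)
      (≋-trans (≋-refl ⊠ ≋-trans e (mid-left s₁ s₂)) (≋-sym (◁◁ _))) e'
  tensor (n-fire {Γ = Δ₁} {A = A} {C = C} {p = p} n₁ n₂) (right s) g₁ (gimp ne ga gc ∷ g₂) gb gB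
    with appendView Δ₁ s
  ... | append {E₁ = E₁} {F₁} {E₂} {F₂} s₁ s₂ e
    with ge₁ , gf₁ ← all-⊗⁻ E₁ g₁ | ge₂ , gf₂ ← all-⊗⁻ E₂ g₂
    with refl ← no-left n₁ s₁ ge₁ ge₂ ga
    with refl ← split-right s₁
    with k₁ , k₂ , e' ← tensor n₂ (appendʳ C s₂) gf₁ (all-⊗ gc gf₂) gb gB =
    k₁ , k₂ ∘ (fire p ▷ F₂) ,
    fire-tensorʳ (sort-appendʳ C s₂) (sort-right-block s₁ s₂ e) e'

  -- Rules of colour false below the elimination of A ⇒ C move into the continuation, left rules of colour
  -- true move into the argument.
  fired : {h : Tm Γ B} → CutFree h → (s : Split Γ Δ Γ₂) (u : Split Δ [ A ⇒ C ] Γ₁) →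
          Good true Γ₁ → Good true A → Good false C → Good false Γ₂ → Good false B → Fired s u h
  fired (n-resp e n) s u g₁ ga gc g₂ gb with φ , f , k , e' ← fired n s u g₁ ga gc g₂ gb =
    φ , f , k , (≈-sym e ⨾≈ e')
  fired {C = C} (n-perm π n) s u g₁ ga gc g₂ gb
    with permSplit π₀ π₂ s' e ← permute π s
    with permSplit ρ₁ ρ₂ u' e' ← permute π₀ u
    -- The marked part is a single factor, so the permutation induced on it is the identity and the
    -- mark survives.
    with ⟦ ρ₁ ⟧ | perm-singleton ρ₁
  ... | _ | ⟪ e₁ ⟫
    with φ , (p , e₂) , k , e₃ ← fired n s' u' (all-perm ρ₂ g₁) ga gc (all-perm π₂ g₂) gb =
    φ ∘ ⟦ π₀ ⟧ ,
    (p ∘ ⟦ ρ₂ ⟧ ,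
     (∘-cong e₂ ≈-refl ⨾≈ ≈-sym (∘-assoc _ _ _) ⨾≈ ∘-cong ≈-refl (e' ⨾≈ ∘-cong (⊗-cong e₁ ≈-refl) ≈-refl) ⨾≈
      ∘-assoc _ _ _ ⨾≈ ∘-cong (≈-sym (fire-nat p ⟦ ρ₂ ⟧)) ≈-refl)) ,
    k ∘ (C ◁ ⟦ π₂ ⟧) ,
    (∘-cong e₃ ≈-refl ⨾≈ ≈-sym (∘-assoc _ _ _) ⨾≈ ∘-cong ≈-refl (≈-sym (∘-assoc _ _ _) ⨾≈ ∘-cong ≈-refl e ⨾≈
      ∘-assoc _ _ _ ⨾≈ ∘-cong (⊗-∘ _ _ _ _ ⨾≈ ⊗-cong ≈-refl (idˡ _) ⨾≈ ⊗-◁▷ _ _) ≈-refl ⨾≈ ≈-sym (∘-assoc _ _ _)) ⨾≈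
      ∘-assoc _ _ _)
  fired {Γ₂ = Γ₂} {C = C} (n-lam A' Γ n) s u g₁ ga gc g₂ (gimp _ ga' gc' ∷ [])
    with φ , f , k , e ← fired n (appendʳ A' s) u g₁ ga gc (all-⊗ ga' g₂) gc' =
    φ , f , curry A' _ (k ∘ σ A' C Γ₂) , curry-fired e (sort-appendʳ A' s)
  fired {C = C} (n-tens {Γ = Δ₁} {Δ = Δ₂} {b = b} {f = f} {g} n₁ n₂) s u g₁ ga gc g₂ (gb ∷ gB)
    with appendView Δ₁ s
  ... | append {E₁ = E₁} {F₁} {E₂} {F₂} s₁ s₂ e
    with ge₂ , gf₂ ← all-⊗⁻ E₂ g₂
    with singleView E₁ u
  -- The marked implication lies in the first premise. The second has a succedent of colour false,
  -- so it takes nothing from `Δ`.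
  ... | inˡ {Y₁ = Y₁} u₁ u₂ e'
    with gy₁ , gy₂ ← all-⊗⁻ Y₁ g₁
    with refl ← split-right u₂
    with refl ← no-left n₂ s₂ gy₂ gf₂ gB
    with refl ← split-right s₂
    with φ , fs , k , e'' ← fired n₁ s₁ u₁ gy₁ ga gc ge₂ (gb ∷ []) =
    cast p refl φ ,
    fires-resp (≋-trans e' (≋-trans (mid-rightʳ u₁ u₂) (⊗-unitʳ-≋ _))) (cast-≋ p refl φ) fs ,
    cast q refl (k ⊗t g) ,
    tensor-firedˡ e'' (cast-≋ q refl _) (cast-≋ p refl φ) (≋-trans e (mid-rightʳ s₁ s₂))
    where
    p : E₁ ≡ E₁ ⊗ I
    p = sym (⊗-unitʳ E₁)
    q : (C ⊗ E₂) ⊗ F₂ ≡ C ⊗ E₂ ⊗ F₂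
    q = ⊗-assoc C E₂ F₂
  ... | inʳ {Y₁ = Y₁} u₁ u₂ e'
    with gy₁ , gy₂ ← all-⊗⁻ Y₁ g₁
    with refl ← split-right u₁
    with refl ← no-left n₁ s₁ gy₁ ge₂ (gb ∷ [])
    with refl ← split-right s₁
    with φ , fs , k , e'' ← fired n₂ s₂ u₂ gy₂ ga gc gf₂ gB =
    φ , fires-resp (≋-trans e' (≋-trans (mid-left u₁ u₂) ⟪ ⊗t-unitˡ _ ⟫)) ≋-refl fs ,
    (f ⊗t k) ∘ σ C Δ₁ F₂ , tensor-firedʳ e'' (≋⇒≈ (≋-trans e (mid-right s₁ s₂)))
  fired {C = C} (n-fire {Γ = Δ₁} {A = A'} {C = C'} {Δ = Δ₂} {p = p} {k} n₁ n₂) (right s) u g₁ ga gc (gimp _ ga' gc' ∷ g₂) gb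
    with appendView Δ₁ s
  ... | append {E₁ = E₁} {F₁} {E₂} {F₂} s₁ s₂ e
    with ge₂ , gf₂ ← all-⊗⁻ E₂ g₂
    with singleView E₁ u
  ... | inˡ {Y₁ = Y₁} u₁ u₂ e'
    with gy₁ , gy₂ ← all-⊗⁻ Y₁ g₁
    with refl ← split-right u₂
    with refl ← no-left n₂ (appendʳ C' s₂) gy₂ (all-⊗ gc' gf₂) gb
    with refl ← split-right s₂
    with φ , fs , k' , e'' ← fired n₁ s₁ u₁ gy₁ ga gc ge₂ ga' =
    cast q refl φ ,
    fires-resp (≋-trans e' (≋-trans (mid-rightʳ u₁ u₂) (⊗-unitʳ-≋ _))) (cast-≋ q refl φ) fs ,
    (k ∘ (fire k' ▷ Δ₂)) ∙[ cong ((A' ⇒ C') ∷_) (sym (⊗-assoc C E₂ Δ₂)) ] σ C (A' ⊸ C') (E₂ ⊗ Δ₂) ,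
    fire-firedᵖ e'' (cast-≋ q refl φ) ≋-refl
      (≋-sym (∙≋ (σ-≡ q) (≋-refl ⊠ ≋-sym (≋-trans e (mid-rightʳ s₁ s₂)))))
    where
    q : E₁ ≡ E₁ ⊗ I
    q = sym (⊗-unitʳ E₁)
    σ-≡ : ∀ {A B B' X} → B ≡ B' → σ A B X ≋ σ A B' X
    σ-≡ refl = ≋-refl
  ... | inʳ {Y₁ = Y₁} u₁ u₂ e'
    with gy₁ , gy₂ ← all-⊗⁻ Y₁ g₁
    with refl ← split-right u₁
    with refl ← no-left n₁ s₁ gy₁ ge₂ ga'
    with refl ← split-right s₁
    with φ , fs , k' , e'' ← fired n₂ (appendʳ C' s₂) u₂ gy₂ ga gc (all-⊗ gc' gf₂) gb =
    φ , fires-resp (≋-trans e' (≋-trans (mid-left u₁ u₂) ⟪ ⊗t-unitˡ _ ⟫)) ≋-refl fs ,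
    k' ∘ (C ◁ (fire p ▷ F₂)) , fire-firedᵏ e'' (sort-appendʳ C' s₂) (sort-right-block s₁ s₂ e)
  -- The rule for the marked implication itself: colours leave its argument exactly the rest of `Δ`
  -- and its continuation exactly `Γ₂`.
  fired {C = C} (n-fire {Γ = Δ₁} {A = A} {Δ = Δ₂} {p = p} {k} n₁ n₂) (left s) (left u) g₁ ga gc g₂ gb
    with refl ← split-right u
    with appendView Δ₁ s
  ... | append {E₁ = E₁} {F₁} {E₂} {F₂} s₁ s₂ e
    with ge₁ , gf₁ ← all-⊗⁻ E₁ g₁ | ge₂ , gf₂ ← all-⊗⁻ E₂ g₂
    with refl ← no-right n₁ s₁ ge₁ ge₂ ga | refl ← no-left n₂ (appendʳ C s₂) gf₁ (all-⊗ gc gf₂) gb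
    with refl ← split-left s₁ | refl ← split-right s₂ =
    fire (cast q refl p) ,
    (cast q refl p , (≈-sym (idʳ _) ⨾≈ ∘-cong ≈-refl (≈-sym (≋⇒≈ (≋-trans (≋-refl ⊠ sort-right u) ⟪ ⊗-id _ _ ⟫))))) ,
    k , ∘-cong ≈-refl (≋⇒≈ (
      fire p ▷ F₂ ≈˘⟨ idʳ _ ⟩
      (fire p ▷ F₂) ∘ 𝟏 _ ≋˘⟨ (fire-≋ (cast-≋ q refl p) ⊠ ≋-refl) ⊚
        ≋-trans (≋-refl ⊠ ≋-trans e (≋-trans (mid-left s₁ s₂) (≋-trans (≋-refl ⊠ sort-right s₂) ⟪ ⊗-id _ _ ⟫))) ⟪ ⊗-id [ A ⇒ C ] _ ⟫ ⟩
      (fire (cast q refl p) ▷ F₂) ∘ ([ A ⇒ C ] ◁ sort s) ∎))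
    where
    q : E₁ ≡ E₁ ⊗ I
    q = sym (⊗-unitʳ E₁)
    fire-≋ : ∀ {Γ Γ' A C} {p : Tm Γ A} {p' : Tm Γ' A} → p ≋ p' → fire {C = C} p ≋ fire {C = C} p'
    fire-≋ ⟪ e ⟫ = ⟪ fire-cong e ⟫
  fired {C = C} (n-fire {Γ = Δ₁} {C = C'} {Δ = Δ₂} {p = p} n₁ n₂) (left s) (right u) (gimp ne ga' gc' ∷ g₁) ga gc g₂ gb
    with appendView Δ₁ s
  ... | append {E₁ = E₁} {F₁} {E₂} {F₂} s₁ s₂ e
    with ge₂ , gf₂ ← all-⊗⁻ E₂ g₂
    with singleView E₁ u
  ... | inˡ {Y₁ = Y₁} u₁ u₂ e'
    with gy₁ , gy₂ ← all-⊗⁻ Y₁ g₁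
    with refl ← split-right u₂
    -- C' would lie in a context of colour true proving the succedent of colour false.
    with () ← same-colour ne gc' (proj₁ (all-⊗⁻ C'
      (monochrome n₂ (all-⊗ (mixed gc') (all-unsplit s₂ (mixed gy₂) (mixed gf₂))) gb)))
  ... | inʳ {Y₁ = Y₁} u₁ u₂ e'
    with gy₁ , gy₂ ← all-⊗⁻ Y₁ g₁
    with refl ← split-right u₁
    with refl ← no-right n₁ s₁ gy₁ ge₂ ga'
    with refl ← split-left s₁
    -- The new factor `C'` has colour true and is unmarked, so it joins the context of the argument.
    with φ , (p' , eφ) , k' , e'' ← fired n₂ (appendˡ C' s₂) (appendʳ C' u₂) (all-⊗ gc' gy₂) ga gc gf₂ gb =
    φ ∘ (fire p ▷ F₁) , (p' ∘ (fire p ▷ _) , fire-absorb eφ (sort-appendʳ C' u₂) (sort-right-block u₁ u₂ e')) ,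
    k' , fire-fired-absorb e'' (sort-appendˡ C' s₂)
      (≋-trans (≋-refl ⊠ ≋-trans e (mid-left s₁ s₂)) (≋-sym (◁◁ _)))
  fired (n-var _) (left []) (right ()) g₁ ga gc g₂ gb
  fired (n-var _) (right []) () g₁ ga gc g₂ gb
  fired n-unit [] () g₁ ga gc g₂ gb

-- Counting letters

mutual
  -- Occurrences of p of sign s in a formula that is itself in positive position.
  cntF : ℕ → Bool → Fm → ℕ
  cntF p s I = 0
  cntF p s (a ∷ A) = cntA p s a + cntF p s A

  cntA : ℕ → Bool → At → ℕ
  cntA p s (var q) = count p s ((q , true) ∷ [])
  cntA p s (B ⇒ C) = cntF p (not s) B + cntF p s C

count-++ : ∀ p s xs ys → count p s (xs ++ ys) ≡ count p s xs + count p s ys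
count-++ p s xs ys = trans (cong length (filter-++ _ xs ys)) (length-++ (filter _ xs))

-- Replaces the polarity that `occF` passes downwards by a change of the sign being counted.
relative : Bool → Bool → Bool
relative s true = s
relative s false = not s

relative-not : ∀ s t → relative s (not t) ≡ not (relative s t)
relative-not s true = refl
relative-not s false = sym (not-involutive s)

mutual
  count-occF : ∀ p s t A → count p s (occF t A) ≡ cntF p (relative s t) A
  count-occF p s t I = refl
  count-occF p s t (a ∷ A) =
    trans (count-++ p s (occA t a) (occF t A)) (cong₂ _+_ (count-occA p s t a) (count-occF p s t A))

  count-occA : ∀ p s t a → count p s (occA t a) ≡ cntA p (relative s t) a
  count-occA p s true (var q) = refl
  -- Decidable equality on ℕ computes through `≡ᵇ`, so this is what has to be abstracted.
  count-occA p true false (var q) with q ≡ᵇ p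
  ... | true = refl
  ... | false = refl
  count-occA p false false (var q) with q ≡ᵇ p
  ... | true = refl
  ... | false = refl
  count-occA p s t (B ⇒ C) = trans (count-++ p s (occF (not t) B) (occF t C))
    (cong₂ _+_ (trans (count-occF p s (not t) B) (cong (λ r → cntF p r B) (relative-not s t))) (count-occF p s t C))

count-here : ∀ p s xs → count p s ((p , s) ∷ xs) ≢ 0
count-here p true xs e with p ≡ᵇ p | ≡⇒≡ᵇ p p refl
... | true | _ with () ← e
count-here p false xs e with p ≡ᵇ p | ≡⇒≡ᵇ p p refl
... | true | _ with () ← e

constant⇒cnt : ∀ A → Constant A → ∀ p s → cntF p s A ≡ 0
constant⇒cnt A e p s = trans (sym (count-occF p s true A)) (cong (count p s) e)

cnt⇒constant : ∀ A → (∀ p s → cntF p s A ≡ 0) → Constant A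
cnt⇒constant A e with occF true A | (λ p s → trans (count-occF p s true A) (e p s))
... | [] | _ = refl
... | (p , s) ∷ xs | e' = ⊥-elim (count-here p s xs (e' p s))

cnt-⊗ : ∀ p s A B → cntF p s (A ⊗ B) ≡ cntF p s A + cntF p s B
cnt-⊗ p s I B = refl
cnt-⊗ p s (a ∷ A) B = trans (cong (cntA p s a +_) (cnt-⊗ p s A B)) (sym (+-assoc (cntA p s a) _ _))

occurrences : ℕ → Bool → Fm → Fm → ℕ
occurrences p s A B = cntF p (not s) A + cntF p s B

count-seqOcc : ∀ p s A B → count p s (seqOcc A B) ≡ occurrences p s A B
count-seqOcc p s A B = trans (count-++ p s (occF false A) (occF true B))
  (cong₂ _+_ (count-occF p s false A) (count-occF p s true B))

-- This half of balance passes to premises because their occurrences add up; equality of the two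
-- signs comes from `term-balanced`.
Linear : Fm → Fm → Set
Linear A B = ∀ p s → occurrences p s A B ≤ 1

absent⊎member : ∀ p s xs → count p s xs ≡ 0 ⊎ p ∈ map proj₁ xs
absent⊎member p s [] = inj₁ refl
absent⊎member p s ((q , t) ∷ xs) with q ≡ᵇ p | ≡ᵇ⇒≡ q p
... | true | e = inj₂ (here (sym (e _)))
... | false | _ with absent⊎member p s xs
...   | inj₁ e = inj₁ e
...   | inj₂ m = inj₂ (there m)

balanced⇒linear : ∀ A B → Balanced A B → Linear A B
balanced⇒linear A B bal p s rewrite sym (count-seqOcc p s A B) with absent⊎member p s (seqOcc A B)
... | inj₁ e = ≤-trans (≤-reflexive e) z≤n
... | inj₂ m with s
...   | true = ≤-reflexive (proj₁ (bal p m))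
...   | false = ≤-reflexive (proj₂ (bal p m))

-- Every primitive term pairs occurrences of opposite signs. At a composition, all occurrences in
-- the middle formula are added to both sides and cancelled.
term-balanced : ∀ p → Tm A B → occurrences p true A B ≡ occurrences p false A B
term-balanced p (𝟏 A) = +-comm (cntF p false A) (cntF p true A)
term-balanced p (c A B)
  rewrite cnt-⊗ p true A B | cnt-⊗ p false A B | cnt-⊗ p true B A | cnt-⊗ p false B A =
  solve 4 (λ a b a' b' → (a' :+ b') :+ (b :+ a) := (a :+ b) :+ (b' :+ a')) refl
    (cntF p true A) (cntF p true B) (cntF p false A) (cntF p false B)
  where open +-*-Solver
term-balanced p (η A B) rewrite cnt-⊗ p true A B | cnt-⊗ p false A B =
  solve 4 (λ a b a' b' → b' :+ (a' :+ (a :+ b) :+ con 0) := b :+ (a :+ (a' :+ b') :+ con 0)) refl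
    (cntF p true A) (cntF p true B) (cntF p false A) (cntF p false B)
  where open +-*-Solver
term-balanced p (ε A B) rewrite cnt-⊗ p true A (A ⊸ B) | cnt-⊗ p false A (A ⊸ B) =
  solve 4 (λ a b a' b' → (a' :+ (a :+ b' :+ con 0)) :+ b := (a :+ (a' :+ b :+ con 0)) :+ b') refl
    (cntF p true A) (cntF p true B) (cntF p false A) (cntF p false B)
  where open +-*-Solver
term-balanced p (_∘_ {A} {B} {C} g f) = +-cancelʳ-≡ (cntF p true B + cntF p false B) _ _ (begin
  (a' + e) + (b + b') ≡⟨ solve 4 (λ a' e b b' → (a' :+ e) :+ (b :+ b') := (a' :+ b) :+ (b' :+ e)) refl a' e b b' ⟩
  (a' + b) + (b' + e) ≡⟨ cong₂ _+_ (term-balanced p f) (term-balanced p g) ⟩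
  (a + b') + (b + e') ≡⟨ solve 4 (λ a e' b b' → (a :+ b') :+ (b :+ e') := (a :+ e') :+ (b :+ b')) refl a e' b b' ⟩
  (a + e') + (b + b') ∎')
  where
  open +-*-Solver
  open ≡-Reasoning renaming (_∎ to _∎')
  a = cntF p true A
  a' = cntF p false A
  b = cntF p true B
  b' = cntF p false B
  e = cntF p true C
  e' = cntF p false C
term-balanced p (_⊗t_ {A₁} {A₂} {B₁} {B₂} f g)
  rewrite cnt-⊗ p true A₁ A₂ | cnt-⊗ p false A₁ A₂ | cnt-⊗ p true B₁ B₂ | cnt-⊗ p false B₁ B₂ =
  trans (interchange a₁' a₂' b₁ b₂) (trans (cong₂ _+_ (term-balanced p f) (term-balanced p g)) (sym (interchange a₁ a₂ b₁' b₂')))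
  where
  open +-*-Solver
  interchange : ∀ a b c d → (a + b) + (c + d) ≡ (a + c) + (b + d)
  interchange = solve 4 (λ a b c d → (a :+ b) :+ (c :+ d) := (a :+ c) :+ (b :+ d)) refl
  a₁ = cntF p true A₁
  a₁' = cntF p false A₁
  a₂ = cntF p true A₂
  a₂' = cntF p false A₂
  b₁ = cntF p true B₁
  b₁' = cntF p false B₁
  b₂ = cntF p true B₂
  b₂' = cntF p false B₂
term-balanced p (_⇒t_ {B₁} {B₂} A f) = begin
  (a + b₁' + 0) + (a' + b₂ + 0) ≡⟨ solve 4 (λ a b₁' a' b₂ → (a :+ b₁' :+ con 0) :+ (a' :+ b₂ :+ con 0) := (a :+ a') :+ (b₁' :+ b₂)) refl a b₁' a' b₂ ⟩
  (a + a') + (b₁' + b₂) ≡⟨ cong (a + a' +_) (term-balanced p f) ⟩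
  (a + a') + (b₁ + b₂') ≡⟨ solve 4 (λ a b₁ a' b₂' → (a :+ a') :+ (b₁ :+ b₂') := (a' :+ b₁ :+ con 0) :+ (a :+ b₂' :+ con 0)) refl a b₁ a' b₂' ⟩
  (a' + b₁ + 0) + (a + b₂' + 0) ∎'
  where
  open +-*-Solver
  open ≡-Reasoning renaming (_∎ to _∎')
  a = cntF p true A
  a' = cntF p false A
  b₁ = cntF p true B₁
  b₁' = cntF p false B₁
  b₂ = cntF p true B₂
  b₂' = cntF p false B₂

-- Reduced formulae and separation of letters

data ReducedAt : At → Set where
  rvar : ∀ {p} → ReducedAt (var p)
  rimp : C ≢ I → All ReducedAt B → All ReducedAt C → ReducedAt (B ⇒ C)

Reduced : Fm → Set
Reduced = All ReducedAt

reduced-letter : Reduced A → A ≢ I → ∃₂ λ p s → cntF p s A ≢ 0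
reduced-letter [] ne = ⊥-elim (ne refl)
reduced-letter {A = var p ∷ A} (rvar ∷ _) ne = p , true , λ e → count-here p true [] (m+n≡0⇒m≡0 _ e)
reduced-letter {A = (B ⇒ C) ∷ A} (rimp ne' _ rc ∷ _) ne with p , s , ne'' ← reduced-letter rc ne' =
  p , s , λ e → ne'' (m+n≡0⇒n≡0 (cntF p (not s) B) (m+n≡0⇒m≡0 _ e))

cnt≡0⇒I : Reduced A → (∀ p s → cntF p s A ≡ 0) → A ≡ I
cnt≡0⇒I [] e = refl
cnt≡0⇒I rs@(_ ∷ _) e with p , s , ne ← reduced-letter rs (λ ()) = ⊥-elim (ne (e p s))

module _ {colour : ℕ → Bool} where
  open Coloured colour

  good : ∀ {b} → Reduced A → (∀ p s → 0 < cntF p s A → colour p ≡ b) → Good b A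
  good [] h = []
  good {A = var p ∷ A} (rvar ∷ rs) h =
    gvar (h p true (m≤n⇒m≤n+o _ (n≢0⇒n>0 (count-here p true [])))) ∷
    good rs (λ q s lt → h q s (m≤n⇒m≤o+n (cntA q s (var p)) lt))
  good {A = (B ⇒ C) ∷ A} (rimp ne rb rc ∷ rs) h =
    gimp ne
      (good rb (λ q s lt → h q (not s) (m≤n⇒m≤n+o _ (m≤n⇒m≤n+o _ (subst (λ t → 0 < cntF q t B) (sym (not-involutive s)) lt)))))
      (good rc (λ q s lt → h q s (m≤n⇒m≤n+o _ (m≤n⇒m≤o+n (cntF q (not s) B) lt)))) ∷
    good rs (λ q s lt → h q s (m≤n⇒m≤o+n (cntA q s (B ⇒ C)) lt))

-- A term equalises the two signs, so an occurrence of either sign entails a positive one. Testing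
-- positive occurrences therefore suffices for the colouring.
present : Tm A B → ∀ p s → 0 < cntF p s A ⊎ 0 < cntF p s B → 0 < occurrences p true A B
present {A} {B} f p true (inj₁ lt) = subst (0 <_) (sym (term-balanced p f)) (m≤n⇒m≤n+o _ lt)
present {A} {B} f p false (inj₁ lt) = m≤n⇒m≤n+o _ lt
present {A} {B} f p true (inj₂ lt) = m≤n⇒m≤o+n (cntF p false A) lt
present {A} {B} f p false (inj₂ lt) = subst (0 <_) (sym (term-balanced p f)) (m≤n⇒m≤o+n (cntF p true A) lt)

occursIn : Fm → Fm → ℕ → Bool
occursIn A B p = does (0 <? occurrences p true A B)

record Separated (A B C D : Fm) : Set where
  field
    colour : ℕ → Bool
  open Coloured colour
  field
    goodA : Good true A
    goodB : Good true B
    goodC : Good false C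
    goodD : Good false D

-- A letter common to both sequents would occur positively in each, exceeding the bound. The colour
-- records occurrence in the first.
separate : Tm A B → Tm C D → (∀ p s → occurrences p s A B + occurrences p s C D ≤ 1) →
           Reduced A → Reduced B → Reduced C → Reduced D → Separated A B C D
separate {A} {B} {C} {D} f g lin ra rb rc rd = record
  { colour = occursIn A B
  ; goodA = good ra (λ p s lt → in₁ p (present f p s (inj₁ lt)))
  ; goodB = good rb (λ p s lt → in₁ p (present f p s (inj₂ lt)))
  ; goodC = good rc (λ p s lt → in₂ p (present g p s (inj₁ lt)))
  ; goodD = good rd (λ p s lt → in₂ p (present g p s (inj₂ lt)))
  }
  where
  in₁ : ∀ p → 0 < occurrences p true A B → occursIn A B p ≡ true
  in₁ p lt = dec-true (0 <? occurrences p true A B) lt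
  in₂ : ∀ p → 0 < occurrences p true C D → occursIn A B p ≡ false
  in₂ p lt = dec-false (0 <? occurrences p true A B) (λ lt' → 1+n≰n (≤-trans (+-mono-≤ lt' lt) (lin p true)))

cnt-perm : ∀ p s → Perm Γ Δ → cntF p s Γ ≡ cntF p s Δ
cnt-perm p s ↭-refl = refl
cnt-perm p s (↭-prep a π) = cong (cntA p s a +_) (cnt-perm p s π)
cnt-perm p s (↭-swap a b Γ) = x∙yz≈y∙xz +-commutativeSemigroup (cntA p s a) (cntA p s b) (cntF p s Γ)
cnt-perm p s (↭-trans π ρ) = trans (cnt-perm p s π) (cnt-perm p s ρ)

-- Uniqueness of the axioms

unit-unique : {h : Tm Γ B} → CutFree h → Γ ≡ I → B ≡ I → h ≋ 𝟏 I
unit-unique (n-resp e n) p q = ≋-trans ⟪ ≈-sym e ⟫ (unit-unique n p q)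
unit-unique (n-perm π n) refl q with ⟦ π ⟧ | perm-I π
... | _ | ⟪ e ⟫ = ≋-trans (unit-unique n refl q ⊚ ⟪ e ⟫) ⟪ idˡ _ ⟫
unit-unique n-unit p q = ≋-refl

var-unique : ∀ {x} {h : Tm Γ B} → CutFree h → Γ ≡ [ var x ] → B ≡ [ var x ] → h ≋ 𝟏 [ var x ]
var-unique (n-resp e n) p q = ≋-trans ⟪ ≈-sym e ⟫ (var-unique n p q)
var-unique (n-perm π n) refl q with ⟦ π ⟧ | perm-singleton π
... | _ | ⟪ e ⟫ = ≋-trans (var-unique n refl q ⊚ ⟪ e ⟫) ⟪ idˡ _ ⟫
var-unique (n-var y) refl q = ≋-refl
-- The second premise would derive `I` from a letter. With all letters coloured true and `I` taken
-- as colour false, `monochrome` refutes this.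
var-unique (n-tens {Γ = I} n₁ n₂) refl refl
  with Coloured.gvar () ∷ _ ← Coloured.monochrome (λ _ → true) {b = false} n₂ ((true , Coloured.gvar refl) ∷ []) []
var-unique (n-tens {Γ = a ∷ I} n₁ n₂) refl refl =
  ≋-trans (var-unique n₁ refl refl ⊠ unit-unique n₂ refl refl) ⟪ ⊗-id _ _ ⟫

-- Coherence

-- `g` stays an arbitrary term and is normalised only at axioms and splitting rules: exchange and
-- the right rule for implication are invertible, so there it is just permuted back or uncurried.
coherence : {f : Tm Γ B} → CutFree f → Reduced Γ → Reduced B → Linear Γ B → (g : Tm Γ B) → f ≈ g
coherence (n-resp e n) rΓ rB lin g = ≈-sym e ⨾≈ coherence n rΓ rB lin g
coherence {B = B} (n-perm {Δ = Δ} π n) rΓ rB lin g =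
  ∘-cong (coherence n (all-perm π rΓ) rB lin' (g ∘ ⟦ perm-sym π ⟧)) ≈-refl ⨾≈
  ≈-sym (∘-assoc _ _ _) ⨾≈ ∘-cong ≈-refl (perm-inv π) ⨾≈ idʳ g
  where
  lin' : Linear Δ B
  lin' p s = subst (λ n → n + cntF p s B ≤ 1) (cnt-perm p (not s) π) (lin p s)
coherence (n-var p) rΓ rB lin g = ≈-sym (≋⇒≈ (var-unique (normalise g) refl refl))
coherence n-unit rΓ rB lin g = ≈-sym (≋⇒≈ (unit-unique (normalise g) refl refl))
coherence (n-tens {Γ = Γ₁} {Γ₂} {B} {b} {f₁} {f₂} n₁ n₂) rΓ (rb ∷ rB) lin g
  with r₁ , r₂ ← all-⊗⁻ Γ₁ rΓ = go
  where
  sum : ∀ p s → occurrences p s (Γ₁ ⊗ Γ₂) (b ∷ B) ≡ occurrences p s Γ₁ [ b ] + occurrences p s Γ₂ B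
  sum p s rewrite cnt-⊗ p (not s) Γ₁ Γ₂ =
    solve 4 (λ u v w x → (u :+ v) :+ (w :+ x) := (u :+ (w :+ con 0)) :+ (v :+ x)) refl
      (cntF p (not s) Γ₁) (cntF p (not s) Γ₂) (cntA p s b) (cntF p s B)
    where open +-*-Solver
  lin' : ∀ p s → occurrences p s Γ₁ [ b ] + occurrences p s Γ₂ B ≤ 1
  lin' p s = subst (_≤ 1) (sum p s) (lin p s)
  sep = separate f₁ f₂ lin' r₁ (rb ∷ []) r₂ rB
  open Separated sep
  go : f₁ ⊗t f₂ ≈ g
  go with gb ∷ [] ← goodB
    with g₁ , g₂ , e ← Coloured.tensor colour (normalise g) (literal Γ₁ Γ₂) goodA goodC gb goodD =
    ⊗-cong (coherence n₁ r₁ (rb ∷ []) (λ p s → m+n≤o⇒m≤o (occurrences p s Γ₁ [ b ]) (lin' p s)) g₁)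
           (coherence n₂ r₂ rB (λ p s → m+n≤o⇒n≤o (occurrences p s Γ₁ [ b ]) (lin' p s)) g₂) ⨾≈
    ≈-sym (e ⨾≈ ∘-cong ≈-refl (sort-literal Γ₁ Γ₂) ⨾≈ idʳ _)
coherence (n-lam A Γ {C} n) rΓ (rimp ne rA rC ∷ []) lin g =
  curry-cong (coherence n (all-⊗ rA rΓ) rC lin' (uncurry g)) ⨾≈ curry-uncurry g
  where
  lin' : Linear (A ⊗ Γ) C
  lin' p s = subst (_≤ 1) eq (lin p s)
    where
    open +-*-Solver
    eq : occurrences p s Γ (A ⊸ C) ≡ occurrences p s (A ⊗ Γ) C
    eq rewrite cnt-⊗ p (not s) A Γ =
      solve 3 (λ u v w → u :+ (v :+ w :+ con 0) := (v :+ u) :+ w) refl (cntF p (not s) Γ) (cntF p (not s) A) (cntF p s C)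
coherence (n-fire {Γ = Γ₁} {A} {C} {Γ₂} {B} {p = a} {k} n₁ n₂) (rimp ne rA rC ∷ rΓ) rB lin g
  with r₁ , r₂ ← all-⊗⁻ Γ₁ rΓ = go
  where
  sum : ∀ p s → occurrences p s ((A ⇒ C) ∷ Γ₁ ⊗ Γ₂) B ≡ occurrences p s Γ₁ A + occurrences p s (C ⊗ Γ₂) B
  sum p s rewrite cnt-⊗ p (not s) Γ₁ Γ₂ | cnt-⊗ p (not s) C Γ₂ | not-involutive s =
    solve 5 (λ u v w x y → ((u :+ v) :+ (w :+ x)) :+ y := (w :+ u) :+ ((v :+ x) :+ y)) refl
      (cntF p s A) (cntF p (not s) C) (cntF p (not s) Γ₁) (cntF p (not s) Γ₂) (cntF p s B)
    where open +-*-Solver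
  lin' : ∀ p s → occurrences p s Γ₁ A + occurrences p s (C ⊗ Γ₂) B ≤ 1
  lin' p s = subst (_≤ 1) (sum p s) (lin p s)
  sep = separate a k lin' r₁ rA (all-⊗ rC r₂) rB
  open Separated sep
  go : k ∘ (fire a ▷ Γ₂) ≈ g
  go with gC , gΓ₂ ← all-⊗⁻ C goodC
    -- The argument sequent has colour true and the continuation colour false, so the principal
    -- implication is of the crossing kind that `fired` finds.
    with φ , (a' , eφ) , k' , e ← Coloured.fired colour (normalise g) (literal ((A ⇒ C) ∷ Γ₁) Γ₂) (literal [ A ⇒ C ] Γ₁)
      goodA goodB gC gΓ₂ goodD =
    ∘-cong (coherence n₂ (all-⊗ rC r₂) rB (λ p s → m+n≤o⇒n≤o (occurrences p s Γ₁ A) (lin' p s)) k')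
      (⊗-cong (fire-cong (coherence n₁ r₁ rA (λ p s → m+n≤o⇒m≤o (occurrences p s Γ₁ A) (lin' p s)) a') ⨾≈
               ≈-sym (eφ ⨾≈ ∘-cong ≈-refl (sort-literal [ A ⇒ C ] Γ₁) ⨾≈ idʳ _)) ≈-refl) ⨾≈
    ≈-sym (e ⨾≈ ∘-cong ≈-refl (∘-cong ≈-refl (sort-literal ((A ⇒ C) ∷ Γ₁) Γ₂) ⨾≈ idʳ _))

-- Reduction of proper formulae

dimap : Tm A' A → Tm C C' → Tm (A ⊸ C) (A' ⊸ C')
dimap {A'} {A} {C} f g = curry A' (A ⊸ C) (g ∘ ε A C ∘ (f ▷ (A ⊸ C)))

dimap-∘ : (f : Tm A' A) (f' : Tm A₁ A') (g : Tm C C') (g' : Tm C' C₁) →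
          dimap f' g' ∘ dimap f g ≈ dimap (f ∘ f') (g' ∘ g)
dimap-∘ f f' g g' =
  ≈-sym (curry-nat _ _) ⨾≈ curry-cong (≈-sym (∘-assoc _ _ _) ⨾≈
    ∘-cong ≈-refl (≈-sym (∘-assoc _ _ _) ⨾≈ ∘-cong ≈-refl (▷◁ _ _) ⨾≈ ∘-assoc _ _ _ ⨾≈
      ∘-cong (uncurry-curry _) ≈-refl ⨾≈ ≈-sym (∘-assoc _ _ _)) ⨾≈
    ∘-assoc _ _ _ ⨾≈ ∘-cong ≈-refl (≈-sym (∘-assoc _ _ _) ⨾≈ ∘-cong ≈-refl (≈-sym (▷-∘ _ _))))

dimap-𝟏 : {f : Tm A A} {g : Tm C C} → f ≈ 𝟏 A → g ≈ 𝟏 C → dimap f g ≈ 𝟏 (A ⊸ C)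
dimap-𝟏 {A} {C} e e' =
  curry-cong (∘-cong e' (∘-cong ≈-refl (⊗-cong e ≈-refl)) ⨾≈ idˡ _) ⨾≈ curry-uncurry (𝟏 (A ⊸ C))

-- A retraction is enough to compare conjugated terms, and equal counts carry linearity over to the
-- reducts.
record Reduction (A : Fm) : Set where
  field
    {reduct} : Fm
    reduced : Reduced reduct
    to : Tm A reduct
    from : Tm reduct A
    from∘to : from ∘ to ≈ 𝟏 A
    cnt-reduct : ∀ p s → cntF p s reduct ≡ cntF p s A

open Reduction

-- Properness yields only a double negation, which can be removed because emptiness of a list is
-- decidable.
constant-stable : ∀ A → ¬ ¬ Constant A → Constant A
constant-stable A nn with occF true A
... | [] = refl
... | _ ∷ _ = ⊥-elim (nn λ ())

⇒-reduction : ∀ B C (rB : Reduction B) (rC : Reduction C) → reduct rC ≢ I → Reduction (B ⊸ C)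
⇒-reduction B C rB rC ne = record
  { reduced = rimp ne (reduced rB) (reduced rC) ∷ []
  ; to = dimap (from rB) (to rC)
  ; from = dimap (to rB) (from rC)
  ; from∘to = dimap-∘ _ _ _ _ ⨾≈ dimap-𝟏 (from∘to rB) (from∘to rC)
  ; cnt-reduct = λ p s → cong (_+ 0) (cong₂ _+_ (cnt-reduct rB p (not s)) (cnt-reduct rC p s))
  }

-- The basic case of collapsing constants: with both sides of an implication reduced to `I`, it too
-- becomes a retract of `I`.
I⊸I-retract : η I I ∘ ε I I ≈ 𝟏 (I ⊸ I)
I⊸I-retract = η-nat I (ε I I) ⨾≈ ∘-cong (⇒-cong (⊗t-unitˡ _)) ≈-refl ⨾≈ tri₂ I I

⇒-reduction-I : ∀ B C (rB : Reduction B) (rC : Reduction C) → reduct rB ≡ I → reduct rC ≡ I → Reduction (B ⊸ C)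
⇒-reduction-I B C
  record { to = i ; from = j ; from∘to = e ; cnt-reduct = cB }
  record { to = i' ; from = j' ; from∘to = e' ; cnt-reduct = cC } refl refl = record
  { reduct = I
  ; reduced = []
  ; to = ε I I ∘ dimap j i'
  ; from = dimap i j' ∘ η I I
  ; from∘to = ≈-sym (∘-assoc _ _ _) ⨾≈
      ∘-cong ≈-refl (∘-assoc _ _ _ ⨾≈ ∘-cong I⊸I-retract ≈-refl ⨾≈ idˡ _) ⨾≈
      dimap-∘ _ _ _ _ ⨾≈ dimap-𝟏 e e'
  ; cnt-reduct = λ p s → cong (_+ 0) (cong₂ _+_ (cB p (not s)) (cC p s))
  }

reduce : ∀ A → Proper A → Reduction A
reduceAt : ∀ a → ProperAt a → Reduction [ a ]

reduce I _ = record
  { reduced = [] ; to = 𝟏 I ; from = 𝟏 I ; from∘to = idˡ _ ; cnt-reduct = λ p s → refl }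
reduce (a ∷ A) (pa , pA) = record
  { reduced = all-⊗ (reduced ra) (reduced rA)
  ; to = to ra ⊗t to rA
  ; from = from ra ⊗t from rA
  ; from∘to = ⊗-∘ _ _ _ _ ⨾≈ ⊗-cong (from∘to ra) (from∘to rA) ⨾≈ ⊗-id [ a ] A
  ; cnt-reduct = λ p s → trans (cnt-⊗ p s (reduct ra) (reduct rA))
      (cong₂ _+_ (trans (cnt-reduct ra p s) (+-identityʳ _)) (cnt-reduct rA p s))
  }
  where
  ra = reduceAt a pa
  rA = reduce A pA

reduceAt (var p) _ = record
  { reduced = rvar ∷ [] ; to = 𝟏 _ ; from = 𝟏 _ ; from∘to = idˡ _ ; cnt-reduct = λ p s → refl }
reduceAt (B ⇒ C) (proper , pB , pC) = go (reduct rC) refl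
  where
  rB = reduce B pB
  rC = reduce C pC
  go : ∀ C' → reduct rC ≡ C' → Reduction (B ⊸ C)
  go (_ ∷ _) e = ⇒-reduction B C rB rC λ e' → case-∷ (trans (sym e) e')
    where
    case-∷ : ∀ {a A} → ¬ (a ∷ A) ≡ I
    case-∷ ()
  -- A reduct `I` means that `C` has no letters. Properness then makes `B` constant, and a reduced
  -- formula without letters is `I`.
  go I e = ⇒-reduction-I B C rB rC (cnt≡0⇒I (reduced rB) λ p s → trans (cnt-reduct rB p s) (constant⇒cnt B constB p s)) e
    where
    constC : Constant C
    constC = cnt⇒constant C λ p s → trans (sym (cnt-reduct rC p s)) (cong (cntF p s) e)
    constB : Constant B
    constB = constant-stable B λ nB → proper (constC , nB)

theorem5p11 : ∀ {A B : Fm} (f g : Tm A B) →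
    Balanced A B → Proper A → Proper B → f ≈ g
theorem5p11 {A} {B} f g balanced pA pB =
  expand f ⨾≈ ∘-cong (∘-cong ≈-refl (coherence (normalise _) (reduced rA) (reduced rB) linear _)) ≈-refl ⨾≈ ≈-sym (expand g)
  where
  rA = reduce A pA
  rB = reduce B pB
  expand : (f : Tm A B) → f ≈ (from rB ∘ (to rB ∘ f ∘ from rA)) ∘ to rA
  expand f = ≈-sym (
    ∘-cong (∘-assoc _ _ _ ⨾≈ ∘-cong (from∘to rB) ≈-refl ⨾≈ idˡ _) ≈-refl ⨾≈
    ≈-sym (∘-assoc _ _ _) ⨾≈ ∘-cong ≈-refl (from∘to rA) ⨾≈ idʳ f)
  linear : Linear (reduct rA) (reduct rB)
  linear p s = subst (_≤ 1) (sym (cong₂ _+_ (cnt-reduct rA p (not s)) (cnt-reduct rB p s))) (balanced⇒linear A B balanced p s)
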